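{- Let $F$ be a finitary set functor with $F\emptyset\neq\emptyset$, with a presentation $\varepsilon\colon H_\Sigma\to F$ and chosen $p'\in\Sigma_0$, $p=\varepsilon_\emptyset(p')$. Then: (1) For $x,y\in\nu F$: $x\le y$ in the order by cutting iff $c(x)\sqsubseteq c(y)$, where $\sqsubseteq$ is the relation on $F^\omega1$ given by $a\sqsubseteq b$ iff $a=b$ or $a=r_n(b)$ for some $n\in\mathbb N$. (2) The poset $\nu F$ (ordered by cutting) and its subposet $\mu F$ (embedded via $m$) have the same conservative completion: $(F^\omega1,\sqsubseteq)$ is a cpo, and it is a conservative completion of $\nu F$ via the embedding $c$ and a conservative completion of $\mu F$ via $c\cdot m$. (3) Ordering $F(\mu F)$ so that $\varphi$ is an order isomorphism and $F(\nu F)$ so that $\tau$ is an order isomorphism, $\tau$ is the unique continuous map $g\colon\nu F\to F(\nu F)$ with $g\cdot m=Fm\cdot\varphi^{ -1}$ (i.e. the unique continuous extension of $\varphi^{ -1}$).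
   Context: $F$ finitary = preserves filtered colimits. $(\mu F,\varphi)$: initial algebra; $(\nu F,\tau)$: terminal coalgebra. Initial-algebra $\omega$-chain $F^n0$ with colimit $F^\omega0=\mu F$ and injections $i_n\colon F^n0\to\mu F$ (with $\varphi\cdot Fi_n=i_{n+1}$); terminal-coalgebra $\omega^{op}$-chain $F^n1$ (connecting maps $F^nt$, $t\colon F1\to1$) with limit $F^\omega1$ and projections $t_n$. $\bar u\colon\mu F\to F^\omega1$ is the unique map with $t_n\bar u i_n=F^nu$ ($u\colon\emptyset\to1$). Regarding $p$ as $1\to F\emptyset$, $r_n=\bar u\cdot i_{n+1}\cdot F^np\cdot t_n\colon F^\omega1\to F^\omega1$. $c\colon\nu F\to F^\omega1$ is the unique map with $t_n\cdot c=c_n$, where $c_0\colon\nu F\to1$ and $c_{n+1}=Fc_n\cdot\tau$; it is injective. $m\colon\mu F\to\nu F$ is the unique coalgebra homomorphism $(\mu F,\varphi^{ -1})\to(\nu F,\tau)$ (injective). Presentation: finitary signature $\Sigma$, $H_\Sigma X=\coprod_n\Sigma_n\times X^n$, natural $\varepsilon\colon H_\Sigma\to F$ with surjective components. $\Sigma$-trees are ordered rooted trees labelled in $\Sigma$ with a node labelled in $\Sigma_n$ having $n$ children; $\nu H_\Sigma$ = all $\Sigma$-trees with $\tau'$ inverse of tree tupling, $\mu H_\Sigma$ = finite $\Sigma$-trees with $\varphi'$ tree tupling. $\partial'_n s$: delete nodes of height $>n$ of $s$ and relabel the nodes of height $n$ by $p'$. $h\colon\mu H_\Sigma\to\mu F$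 is the unique $\Sigma$-algebra homomorphism into $(\mu F,\varphi\cdot\varepsilon_{\mu F})$, and $\sim$ is its kernel. $s\sim^*s'$ iff $\partial'_ns\sim\partial'_ns'$ for all $n$. $\hat k\colon\nu H_\Sigma\to\nu F$ is the unique $F$-coalgebra homomorphism $(\nu H_\Sigma,\varepsilon_{\nu H_\Sigma}\tau')\to(\nu F,\tau)$; it is known to be surjective with kernel $\sim^*$. Order by cutting on $\nu F$: $x\le y$ iff $x=y$ or $x=\hat k(s)$, $y=\hat k(s')$ with $s\sim^*\partial'_ns'$ for some $n$ (independent of representatives). $\mu F$ carries the order induced via $m$. Continuous = monotone and preserving existing directed joins. A conservative completion of a poset $P$ is a cpo $\bar P$ containing $P$ as a subposet closed under existing directed joins, such that every continuous $f\colon P\to Q$ into a cpo $Q$ has a unique continuous extension $\bar P\to Q$. -}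

module Defs where

open import Level using (Level) renaming (suc to lsuc)
open import Data.Nat.Base using (ℕ; zero; suc; _<_)
open import Data.Nat.Properties using (_<?_)
open import Data.Fin.Base using (Fin; toℕ; fromℕ<)
open import Data.Fin.Properties using (toℕ<n; fromℕ<-toℕ; toℕ-fromℕ<)
open import Data.Empty.Polymorphic using (⊥)
open import Data.Unit.Polymorphic using (⊤; tt)
open import Data.Maybe using (Is-just; to-witness)
open import Data.List.Base using (List; []; _∷_; _∷ʳ_)
open import Data.Maybe.Base using (Maybe; just; nothing; maybe′)
open import Data.Maybe.Relation.Binary.Pointwise as Maybe using (just; nothing)
open import Data.Maybe.Relation.Unary.Any using (just)
open import Data.Product.Base using (Σ; Σ-syntax; ∃; ∃-syntax; _×_; _,_; proj₁; proj₂)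
open import Data.Sum.Base using (_⊎_)
open import Function.Base using (_on_)
open import Function.Bundles using (Func; _⟨$⟩_; _⇔_; mk⇔; module Equivalence)
open import Function.Construct.Composition using () renaming (function to compose)
open import Function.Construct.Identity using () renaming (function to identity)
open import Function.Definitions using (Injective; Surjective)
open import Relation.Binary.Bundles using (Setoid; Poset)
open import Relation.Binary.Core using (Rel)
open import Relation.Binary.Morphism.Structures using (IsOrderHomomorphism; IsOrderMonomorphism; IsOrderIsomorphism)
open import Relation.Binary.Morphism.OrderMonomorphism using () renaming (isPartialOrder to pullBackPartialOrder)
open import Relation.Binary.Structures using (IsPartialOrder)
open import Relation.Binary.PropositionalEquality as ≡ using (_≡_)
open import Relation.Nullary.Decidable.Core using (yes; no)
open import Relation.Nullary.Negation.Core using (contradiction)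

open Func using (to; cong)
open Setoid using (Carrier)

private
  variable
    ℓ : Level

------------------------------------------------------------------------
-- The category of sets.  A set is rendered as a setoid and a map as a
-- function respecting the equalities, since plain types have neither
-- quotients nor function extensionality.

infix 3 _⇒_
infix 4 _≋_
infixr 9 _∘ₛ_

_⇒_ : Setoid ℓ ℓ → Setoid ℓ ℓ → Set ℓ
A ⇒ B = Func A B

_≋_ : {A B : Setoid ℓ ℓ} → A ⇒ B → A ⇒ B → Set ℓ
_≋_ {A = A} {B} f g = ∀ (x : Carrier A) → Setoid._≈_ B (f ⟨$⟩ x) (g ⟨$⟩ x)

_∘ₛ_ : {A B C : Setoid ℓ ℓ} → B ⇒ C → A ⇒ B → A ⇒ C
g ∘ₛ f = compose f g

idₛ : (A : Setoid ℓ ℓ) → A ⇒ A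
idₛ A = identity A

𝟘 𝟙 : (ℓ : Level) → Setoid ℓ ℓ
𝟘 ℓ = ≡.setoid (⊥ {ℓ})
𝟙 ℓ = ≡.setoid (⊤ {ℓ})

fromEmpty : (A : Setoid ℓ ℓ) → 𝟘 ℓ ⇒ A
fromEmpty A = record { to = λ () ; cong = λ { {()} } }

toUnit : (A : Setoid ℓ ℓ) → A ⇒ 𝟙 ℓ
toUnit A = record { to = λ _ → tt ; cong = λ _ → ≡.refl }

point : (A : Setoid ℓ ℓ) → Carrier A → 𝟙 ℓ ⇒ A
point A a = record { to = λ _ → a ; cong = λ _ → Setoid.refl A }

record SetFunctor (ℓ : Level) : Set (lsuc ℓ) where
  field
    F₀        : Setoid ℓ ℓ → Setoid ℓ ℓ
    F₁        : {A B : Setoid ℓ ℓ} → A ⇒ B → F₀ A ⇒ F₀ B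
    F-resp-≋  : {A B : Setoid ℓ ℓ} {f g : A ⇒ B} → f ≋ g → F₁ f ≋ F₁ g
    F-id      : {A : Setoid ℓ ℓ} → F₁ (idₛ A) ≋ idₛ (F₀ A)
    F-∘       : {A B C : Setoid ℓ ℓ} (g : B ⇒ C) (f : A ⇒ B) → F₁ (g ∘ₛ f) ≋ F₁ g ∘ₛ F₁ f

open SetFunctor using (F₀; F₁; F-resp-≋; F-id; F-∘)

------------------------------------------------------------------------
-- Finitary functors

record SmallCategory (ℓ : Level) : Set (lsuc ℓ) where
  infixr 9 _∘_
  field
    Obj    : Set ℓ
    Hom    : Obj → Obj → Setoid ℓ ℓ
    id     : {a : Obj} → Carrier (Hom a a)
    _∘_    : {a b c : Obj} → Carrier (Hom b c) → Carrier (Hom a b) → Carrier (Hom a c)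

  _≈_ : {a b : Obj} → Rel (Carrier (Hom a b)) ℓ
  _≈_ {a} {b} = Setoid._≈_ (Hom a b)

  field
    ∘-resp : {a b c : Obj} {g g′ : Carrier (Hom b c)} {f f′ : Carrier (Hom a b)} →
             g ≈ g′ → f ≈ f′ → (g ∘ f) ≈ (g′ ∘ f′)
    idˡ    : {a b : Obj} {f : Carrier (Hom a b)} → (id ∘ f) ≈ f
    idʳ    : {a b : Obj} {f : Carrier (Hom a b)} → (f ∘ id) ≈ f
    assoc  : {a b c d : Obj} {h : Carrier (Hom c d)} {g : Carrier (Hom b c)} {f : Carrier (Hom a b)} →
             ((h ∘ g) ∘ f) ≈ (h ∘ (g ∘ f))

record IsFiltered (J : SmallCategory ℓ) : Set ℓ where
  open SmallCategory J
  field
    object     : Obj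
    bound      : ∀ a b → ∃[ c ] (Carrier (Hom a c) × Carrier (Hom b c))
    coequalise : ∀ {a b} (f g : Carrier (Hom a b)) →
                 ∃[ c ] Σ[ h ∈ Carrier (Hom b c) ] ((h ∘ f) ≈ (h ∘ g))

record Diagram (J : SmallCategory ℓ) : Set (lsuc ℓ) where
  open SmallCategory J
  field
    D₀       : Obj → Setoid ℓ ℓ
    D₁       : ∀ {a b} → Carrier (Hom a b) → D₀ a ⇒ D₀ b
    D-resp-≈ : ∀ {a b} {f g : Carrier (Hom a b)} → f ≈ g → D₁ f ≋ D₁ g
    D-id     : ∀ {a} → D₁ (id {a}) ≋ idₛ (D₀ a)
    D-∘      : ∀ {a b c} (g : Carrier (Hom b c)) (f : Carrier (Hom a b)) → D₁ (g ∘ f) ≋ D₁ g ∘ₛ D₁ f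

record Cocone {J : SmallCategory ℓ} (D : Diagram J) : Set (lsuc ℓ) where
  open SmallCategory J
  open Diagram D
  field
    apex     : Setoid ℓ ℓ
    leg      : ∀ a → D₀ a ⇒ apex
    commutes : ∀ {a b} (f : Carrier (Hom a b)) → leg b ∘ₛ D₁ f ≋ leg a

open Cocone using (apex; leg; commutes)

IsColimit : {J : SmallCategory ℓ} {D : Diagram J} → Cocone D → Set (lsuc ℓ)
IsColimit {J = J} {D} K =
  (L : Cocone D) →
  Σ[ f ∈ apex K ⇒ apex L ]
    (∀ a → f ∘ₛ leg K a ≋ leg L a) ×
    (∀ (g : apex K ⇒ apex L) → (∀ a → g ∘ₛ leg K a ≋ leg L a) → g ≋ f)

module _ (F : SetFunctor ℓ) where

  mapDiagram : {J : SmallCategory ℓ} → Diagram J → Diagram J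
  mapDiagram D = record
    { D₀       = λ a → F₀ F (D₀ a)
    ; D₁       = λ f → F₁ F (D₁ f)
    ; D-resp-≈ = λ f≈g → F-resp-≋ F (D-resp-≈ f≈g)
    ; D-id     = λ {a} x → Setoid.trans (F₀ F (D₀ a)) (F-resp-≋ F D-id x) (F-id F x)
    ; D-∘      = λ {c = c} g f x →
                   Setoid.trans (F₀ F (D₀ c)) (F-resp-≋ F (D-∘ g f) x) (F-∘ F (D₁ g) (D₁ f) x)
    } where open Diagram D

  mapCocone : {J : SmallCategory ℓ} {D : Diagram J} → Cocone D → Cocone (mapDiagram D)
  mapCocone {D = D} K = record
    { apex     = F₀ F (apex K)
    ; leg      = λ a → F₁ F (leg K a)
    ; commutes = λ {a} {b} f x →
        let open Setoid (F₀ F (apex K)) in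
        trans (sym (F-∘ F (leg K b) (Diagram.D₁ D f) x)) (F-resp-≋ F (commutes K f) x)
    }

Finitary : SetFunctor ℓ → Set (lsuc ℓ)
Finitary {ℓ} F = {J : SmallCategory ℓ} → IsFiltered J →
                 {D : Diagram J} (K : Cocone D) → IsColimit K → IsColimit (mapCocone F K)

------------------------------------------------------------------------
-- Initial algebras and terminal coalgebras

record InitialAlgebra (F : SetFunctor ℓ) : Set (lsuc ℓ) where
  field
    μ           : Setoid ℓ ℓ
    φ           : F₀ F μ ⇒ μ
    fold        : {A : Setoid ℓ ℓ} → F₀ F A ⇒ A → μ ⇒ A
    fold-hom    : {A : Setoid ℓ ℓ} (a : F₀ F A ⇒ A) → fold a ∘ₛ φ ≋ a ∘ₛ F₁ F (fold a)
    fold-unique : {A : Setoid ℓ ℓ} (a : F₀ F A ⇒ A) (f : μ ⇒ A) → f ∘ₛ φ ≋ a ∘ₛ F₁ F f → f ≋ fold a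

  private
    module M = Setoid μ
    module FM = Setoid (F₀ F μ)

  -- The inverse of φ, by Lambek's lemma.
  φ⁻¹ : μ ⇒ F₀ F μ
  φ⁻¹ = fold (F₁ F φ)

  φφ⁻¹ : φ ∘ₛ φ⁻¹ ≋ idₛ μ
  φφ⁻¹ x = M.trans
    (fold-unique φ (φ ∘ₛ φ⁻¹)
      (λ y → cong φ (FM.trans (fold-hom (F₁ F φ) y) (FM.sym (F-∘ F φ φ⁻¹ y)))) x)
    (M.sym (fold-unique φ (idₛ μ) (λ y → cong φ (FM.sym (F-id F y))) x))

  φ⁻¹φ : φ⁻¹ ∘ₛ φ ≋ idₛ (F₀ F μ)
  φ⁻¹φ x = FM.trans (fold-hom (F₁ F φ) x)
    (FM.trans (FM.sym (F-∘ F φ φ⁻¹ x)) (FM.trans (F-resp-≋ F φφ⁻¹ x) (F-id F x)))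

record TerminalCoalgebra (F : SetFunctor ℓ) : Set (lsuc ℓ) where
  field
    ν             : Setoid ℓ ℓ
    τ             : ν ⇒ F₀ F ν
    unfold        : {A : Setoid ℓ ℓ} → A ⇒ F₀ F A → A ⇒ ν
    unfold-hom    : {A : Setoid ℓ ℓ} (a : A ⇒ F₀ F A) → τ ∘ₛ unfold a ≋ F₁ F (unfold a) ∘ₛ a
    unfold-unique : {A : Setoid ℓ ℓ} (a : A ⇒ F₀ F A) (f : A ⇒ ν) → τ ∘ₛ f ≋ F₁ F f ∘ₛ a → f ≋ unfold a

  private
    module N = Setoid ν
    module FN = Setoid (F₀ F ν)

  τ⁻¹ : F₀ F ν ⇒ ν
  τ⁻¹ = unfold (F₁ F τ)

  τ⁻¹τ : τ⁻¹ ∘ₛ τ ≋ idₛ ν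
  τ⁻¹τ x = N.trans
    (unfold-unique τ (τ⁻¹ ∘ₛ τ)
      (λ y → FN.trans (unfold-hom (F₁ F τ) (τ ⟨$⟩ y)) (FN.sym (F-∘ F τ⁻¹ τ (τ ⟨$⟩ y)))) x)
    (N.sym (unfold-unique τ (idₛ ν) (λ y → FN.sym (F-id F (τ ⟨$⟩ y))) x))

  ττ⁻¹ : τ ∘ₛ τ⁻¹ ≋ idₛ (F₀ F ν)
  ττ⁻¹ x = FN.trans (unfold-hom (F₁ F τ) x)
    (FN.trans (FN.sym (F-∘ F τ⁻¹ τ x)) (FN.trans (F-resp-≋ F τ⁻¹τ x) (F-id F x)))

------------------------------------------------------------------------
-- The initial-algebra chain and the terminal-coalgebra chain

module _ (F : SetFunctor ℓ) where

  -- A ^ n is FⁿA.  As Fⁿ(FA) and Fⁿ⁺¹A are not definitionally equal, the maps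
  -- t^ n = Fⁿt and p^ p n = Fⁿp are given by their own recursions, with the
  -- second representation of that set.
  infixl 10 _^_
  _^_ : Setoid ℓ ℓ → ℕ → Setoid ℓ ℓ
  A ^ zero  = A
  A ^ suc n = F₀ F (A ^ n)

  map^ : {A B : Setoid ℓ ℓ} → A ⇒ B → ∀ n → A ^ n ⇒ B ^ n
  map^ f zero    = f
  map^ f (suc n) = F₁ F (map^ f n)

  u^ : ∀ n → 𝟘 ℓ ^ n ⇒ 𝟙 ℓ ^ n
  u^ = map^ (fromEmpty (𝟙 ℓ))

  t^ : ∀ n → 𝟙 ℓ ^ suc n ⇒ 𝟙 ℓ ^ n
  t^ zero    = toUnit (F₀ F (𝟙 ℓ))
  t^ (suc n) = F₁ F (t^ n)

  p^ : Carrier (F₀ F (𝟘 ℓ)) → ∀ n → 𝟙 ℓ ^ n ⇒ 𝟘 ℓ ^ suc n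
  p^ p zero    = point (F₀ F (𝟘 ℓ)) p
  p^ p (suc n) = F₁ F (p^ p n)

  F^ω1 : Setoid ℓ ℓ
  F^ω1 = record
    { Carrier       = Σ[ x ∈ (∀ n → Carrier (𝟙 ℓ ^ n)) ]
                        (∀ n → Setoid._≈_ (𝟙 ℓ ^ n) (t^ n ⟨$⟩ x (suc n)) (x n))
    ; _≈_           = λ x y → ∀ n → Setoid._≈_ (𝟙 ℓ ^ n) (proj₁ x n) (proj₁ y n)
    ; isEquivalence = record
      { refl  = λ n → Setoid.refl (𝟙 ℓ ^ n)
      ; sym   = λ x≈y n → Setoid.sym (𝟙 ℓ ^ n) (x≈y n)
      ; trans = λ x≈y y≈z n → Setoid.trans (𝟙 ℓ ^ n) (x≈y n) (y≈z n)
      }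
    }

  proj : ∀ n → F^ω1 ⇒ 𝟙 ℓ ^ n
  proj n = record { to = λ x → proj₁ x n ; cong = λ x≈y → x≈y n }

  module _ (I : InitialAlgebra F) where
    open InitialAlgebra I

    inj : ∀ n → 𝟘 ℓ ^ n ⇒ μ
    inj zero    = fromEmpty μ
    inj (suc n) = φ ∘ₛ F₁ F (inj n)

    -- The equations that determine ū : μF → F^ω1, μF being the colimit of the
    -- chain Fⁿ0 with injections inj n.
    Is-ū : μ ⇒ F^ω1 → Set ℓ
    Is-ū ū = ∀ n → proj n ∘ₛ ū ∘ₛ inj n ≋ u^ n

    r : μ ⇒ F^ω1 → Carrier (F₀ F (𝟘 ℓ)) → ∀ n → F^ω1 ⇒ F^ω1
    r ū p n = ū ∘ₛ inj (suc n) ∘ₛ p^ p n ∘ₛ proj n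

    -- a ⊑ b
    Below : μ ⇒ F^ω1 → Carrier (F₀ F (𝟘 ℓ)) → Rel (Carrier F^ω1) ℓ
    Below ū p a b = a ≈ b ⊎ ∃[ n ] a ≈ (r ū p n ⟨$⟩ b)
      where open Setoid F^ω1 using (_≈_)

  module _ (T : TerminalCoalgebra F) where
    open TerminalCoalgebra T

    c^ : ∀ n → ν ⇒ 𝟙 ℓ ^ n
    c^ zero    = toUnit ν
    c^ (suc n) = F₁ F (c^ n) ∘ₛ τ

    c^-compatible : ∀ n → t^ n ∘ₛ c^ (suc n) ≋ c^ n
    c^-compatible zero    x = ≡.refl
    c^-compatible (suc n) x = trans (sym (F-∘ F (t^ n) (c^ (suc n)) (τ ⟨$⟩ x)))
                                    (F-resp-≋ F (c^-compatible n) (τ ⟨$⟩ x))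
      where open Setoid (𝟙 ℓ ^ suc n)

    c : ν ⇒ F^ω1
    c = record
      { to   = λ x → (λ n → c^ n ⟨$⟩ x) , λ n → c^-compatible n x
      ; cong = λ x≈y n → cong (c^ n) x≈y
      }

    m : (I : InitialAlgebra F) → InitialAlgebra.μ I ⇒ ν
    m I = unfold (InitialAlgebra.φ⁻¹ I)

------------------------------------------------------------------------
-- Signatures and presentations

Signature : (ℓ : Level) → Set (lsuc ℓ)
Signature ℓ = ℕ → Setoid ℓ ℓ

module _ (Sg : Signature ℓ) where

  Symbol : Set ℓ
  Symbol = Σ[ n ∈ ℕ ] Carrier (Sg n)

  data _≈Symbol_ : Rel Symbol ℓ where
    sym≈ : ∀ {n} {σ σ′ : Carrier (Sg n)} → Setoid._≈_ (Sg n) σ σ′ → (n , σ) ≈Symbol (n , σ′)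

  symbolSetoid : Setoid ℓ ℓ
  symbolSetoid = record
    { Carrier       = Symbol
    ; _≈_           = _≈Symbol_
    ; isEquivalence = record
      { refl  = λ { {n , _} → sym≈ (Setoid.refl (Sg n)) }
      ; sym   = λ { (sym≈ {n} e) → sym≈ (Setoid.sym (Sg n) e) }
      ; trans = λ { (sym≈ {n} d) (sym≈ e) → sym≈ (Setoid.trans (Sg n) d e) }
      }
    }

  Flat : Set ℓ → Set ℓ
  Flat X = Σ[ n ∈ ℕ ] Carrier (Sg n) × (Fin n → X)

  module _ (X : Setoid ℓ ℓ) where

    private module X = Setoid X

    data _≈Flat_ : Rel (Flat X.Carrier) ℓ where
      flat≈ : ∀ {n} {σ σ′ : Carrier (Sg n)} {xs ys : Fin n → X.Carrier} →
              Setoid._≈_ (Sg n) σ σ′ → (∀ i → xs i X.≈ ys i) → (n , σ , xs) ≈Flat (n , σ′ , ys)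

    flatSetoid : Setoid ℓ ℓ
    flatSetoid = record
      { Carrier       = Flat X.Carrier
      ; _≈_           = _≈Flat_
      ; isEquivalence = record
        { refl  = λ { {n , _} → flat≈ (Setoid.refl (Sg n)) (λ _ → X.refl) }
        ; sym   = λ { (flat≈ {n} e es) → flat≈ (Setoid.sym (Sg n) e) (λ i → X.sym (es i)) }
        ; trans = λ { (flat≈ {n} d ds) (flat≈ e es) →
                        flat≈ (Setoid.trans (Sg n) d e) (λ i → X.trans (ds i) (es i)) }
        }
      }

  H : SetFunctor ℓ
  H = record
    { F₀       = flatSetoid
    ; F₁       = λ f → record
      { to   = λ { (n , σ , xs) → n , σ , λ i → f ⟨$⟩ xs i }
      ; cong = λ { (flat≈ e es) → flat≈ e (λ i → cong f (es i)) }
      }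
    ; F-resp-≋ = λ { f≋g (n , σ , xs) → flat≈ (Setoid.refl (Sg n)) (λ i → f≋g (xs i)) }
    ; F-id     = λ {A} _ → Setoid.refl (flatSetoid A)
    ; F-∘      = λ {C = C} _ _ _ → Setoid.refl (flatSetoid C)
    }

record Presentation (F : SetFunctor ℓ) (Sg : Signature ℓ) : Set (lsuc ℓ) where
  field
    ε          : (X : Setoid ℓ ℓ) → F₀ (H Sg) X ⇒ F₀ F X
    natural    : {X Y : Setoid ℓ ℓ} (f : X ⇒ Y) → F₁ F f ∘ₛ ε X ≋ ε Y ∘ₛ F₁ (H Sg) f
    surjective : (X : Setoid ℓ ℓ) →
                 Surjective (Setoid._≈_ (F₀ (H Sg) X)) (Setoid._≈_ (F₀ F X)) (to (ε X))

------------------------------------------------------------------------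
-- Σ-trees

module _ (Sg : Signature ℓ) where

  arity : Maybe (Symbol Sg) → ℕ
  arity = maybe′ proj₁ 0

  -- A Σ-tree is a labelled tree domain: nodes are addresses, given by the
  -- list of child indices read from the root, and an address that is not a
  -- node is labelled nothing.  Since arity nothing is 0, the second
  -- condition also says that addresses of nodes are closed under prefixes.
  record Tree : Set ℓ where
    field
      label    : List ℕ → Maybe (Symbol Sg)
      root     : Is-just (label [])
      children : ∀ w i → Is-just (label (w ∷ʳ i)) ⇔ (i < arity (label w))

  open Tree

  _≈Label_ : Rel (Maybe (Symbol Sg)) ℓ
  _≈Label_ = Maybe.Pointwise (_≈Symbol_ Sg)

  private module Label = Setoid (Maybe.setoid (symbolSetoid Sg))

  νH : Setoid ℓ ℓ
  νH = record
    { Carrier       = Tree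
    ; _≈_           = λ s s′ → ∀ w → label s w ≈Label label s′ w
    ; isEquivalence = record
      { refl  = λ w → Label.refl
      ; sym   = λ e w → Label.sym (e w)
      ; trans = λ d e w → Label.trans (d w) (e w)
      }
    }

  branch : ∀ {n} → (Fin n → Tree) → ℕ → List ℕ → Maybe (Symbol Sg)
  branch {n} ss i w with i <? n
  ... | yes i<n = label (ss (fromℕ< i<n)) w
  ... | no  _   = nothing

  branch-root : ∀ {n} (ss : Fin n → Tree) i → Is-just (branch ss i []) ⇔ (i < n)
  branch-root {n} ss i with i <? n
  ... | yes i<n = mk⇔ (λ _ → i<n) (λ _ → root (ss (fromℕ< i<n)))
  ... | no  i≮n = mk⇔ (λ ()) (λ i<n → contradiction i<n i≮n)

  branch-children : ∀ {n} (ss : Fin n → Tree) j w i →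
                    Is-just (branch ss j (w ∷ʳ i)) ⇔ (i < arity (branch ss j w))
  branch-children {n} ss j w i with j <? n
  ... | yes j<n = children (ss (fromℕ< j<n)) w i
  ... | no  _   = mk⇔ (λ ()) (λ ())

  branch-cong : ∀ {n} (ss ss′ : Fin n → Tree) → (∀ i → Setoid._≈_ νH (ss i) (ss′ i)) →
                ∀ j w → branch ss j w ≈Label branch ss′ j w
  branch-cong {n} ss ss′ e j w with j <? n
  ... | yes j<n = e (fromℕ< j<n) w
  ... | no  _   = nothing

  branch-toℕ : ∀ {n} (ss : Fin n → Tree) i w → branch ss (toℕ i) w ≡ label (ss i) w
  branch-toℕ {n} ss i w with toℕ i <? n
  ... | yes i<n = ≡.cong (λ k → label (ss k) w) (fromℕ<-toℕ i i<n)
  ... | no  i≮n = contradiction (toℕ<n i) i≮n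

  branch-fromℕ< : ∀ {n} (ss : Fin n → Tree) (f : ℕ → List ℕ → Maybe (Symbol Sg)) →
                  (∀ i w → label (ss i) w ≡ f (toℕ i) w) →
                  (∀ j w → Is-just (f j w) → j < n) →
                  ∀ j w → branch ss j w ≈Label f j w
  branch-fromℕ< {n} ss f e d j w with j <? n
  ... | yes j<n = Label.reflexive (≡.trans (e (fromℕ< j<n) w) (≡.cong (λ k → f k w) (toℕ-fromℕ< j<n)))
  ... | no  j≮n with f j w in eq
  ...   | nothing = nothing
  ...   | just _  = contradiction (d j w (≡.subst Is-just (≡.sym eq) (just _))) j≮n

  tupleLabel : Flat Sg Tree → List ℕ → Maybe (Symbol Sg)
  tupleLabel (n , σ , ss) []      = just (n , σ)
  tupleLabel (n , σ , ss) (i ∷ w) = branch ss i w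

  tuple : Flat Sg Tree → Tree
  tuple (n , σ , ss) = record
    { label    = tupleLabel (n , σ , ss)
    ; root     = just _
    ; children = λ { [] i → branch-root ss i ; (j ∷ w) i → branch-children ss j w i }
    }

  private
    to-witness-arity : {l : Maybe (Symbol Sg)} (j : Is-just l) → proj₁ (to-witness j) ≡ arity l
    to-witness-arity (just _) = ≡.refl

    to-witness-≡ : {l : Maybe (Symbol Sg)} (j : Is-just l) → just (to-witness j) ≡ l
    to-witness-≡ (just _) = ≡.refl

    to-witness-cong : {l l′ : Maybe (Symbol Sg)} (j : Is-just l) (j′ : Is-just l′) → l ≈Label l′ →
                      _≈Symbol_ Sg (to-witness j) (to-witness j′)
    to-witness-cong (just _) (just _) (just e) = e

  rootSymbol : Tree → Symbol Sg
  rootSymbol s = to-witness (root s)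

  subtree : (s : Tree) → Fin (proj₁ (rootSymbol s)) → Tree
  subtree s i = record
    { label    = λ w → label s (toℕ i ∷ w)
    ; root     = Equivalence.from (children s [] (toℕ i))
                   (≡.subst (toℕ i <_) (to-witness-arity (root s)) (toℕ<n i))
    ; children = λ w → children s (toℕ i ∷ w)
    }

  untuple : Tree → Flat Sg Tree
  untuple s = proj₁ (rootSymbol s) , proj₂ (rootSymbol s) , subtree s

  private
    flat≈′ : {a b : Symbol Sg} (ss : Fin (proj₁ a) → Tree) (ss′ : Fin (proj₁ b) → Tree) →
             _≈Symbol_ Sg a b →
             (∀ i j → toℕ i ≡ toℕ j → Setoid._≈_ νH (ss i) (ss′ j)) →
             _≈Flat_ Sg νH (proj₁ a , proj₂ a , ss) (proj₁ b , proj₂ b , ss′)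
    flat≈′ ss ss′ (sym≈ e) es = flat≈ e (λ i → es i i ≡.refl)

  τ′ : νH ⇒ F₀ (H Sg) νH
  τ′ = record
    { to   = untuple
    ; cong = λ {s} {s′} e → flat≈′ (subtree s) (subtree s′) (to-witness-cong (root s) (root s′) (e []))
               (λ i j i≡j w → ≡.subst (λ k → label s (toℕ i ∷ w) ≈Label label s′ (k ∷ w)) i≡j (e (toℕ i ∷ w)))
    }

  τ′-tuple : ∀ x → Setoid._≈_ (F₀ (H Sg) νH) (untuple (tuple x)) x
  τ′-tuple (n , σ , ss) = flat≈ (Setoid.refl (Sg n)) (λ i w → Label.reflexive (branch-toℕ ss i w))

  private
    parent : (s : Tree) (v : List ℕ) (j : ℕ) → Is-just (label s (v ∷ʳ j)) → Is-just (label s v)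
    parent s v j d with label s v | Equivalence.to (children s v j) d
    ... | just _ | _ = just _

    first : (f : List ℕ → Maybe (Symbol Sg)) →
            (∀ w i → Is-just (f (w ∷ʳ i)) → Is-just (f w)) →
            ∀ w → Is-just (f w) → Is-just (f [])
    first f up []      d = d
    first f up (i ∷ w) d = up [] i (first (λ v → f (i ∷ v)) (λ v → up (i ∷ v)) w d)

  tuple-τ′ : ∀ s → Setoid._≈_ νH (tuple (untuple s)) s
  tuple-τ′ s []      = Label.reflexive (to-witness-≡ (root s))
  tuple-τ′ s (i ∷ w) = branch-fromℕ< (subtree s) (λ j v → label s (j ∷ v)) (λ _ _ → ≡.refl)
    (λ j v d → ≡.subst (j <_) (≡.sym (to-witness-arity (root s)))
                 (Equivalence.to (children s [] j)
                   (first (λ v → label s (j ∷ v)) (λ v → parent s (j ∷ v)) v d)))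
    i w

  data FiniteTree : Set ℓ where
    node : ∀ {n} → Carrier (Sg n) → (Fin n → FiniteTree) → FiniteTree

  ⌈_⌉ : FiniteTree → Tree
  ⌈ node {n} σ ss ⌉ = tuple (n , σ , λ i → ⌈ ss i ⌉)

  ∂′ : Carrier (Sg 0) → ℕ → Tree → FiniteTree
  ∂′ p′ zero    s = node p′ (λ ())
  ∂′ p′ (suc n) s = node (proj₂ (rootSymbol s)) (λ i → ∂′ p′ n (subtree s i))

------------------------------------------------------------------------
-- Order by cutting

module _ {F : SetFunctor ℓ} {Sg : Signature ℓ} (P : Presentation F Sg) where
  open Presentation P

  basePoint : Carrier (Sg 0) → Carrier (F₀ F (𝟘 ℓ))
  basePoint p′ = ε (𝟘 ℓ) ⟨$⟩ (0 , p′ , λ ())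

  k̂ : (T : TerminalCoalgebra F) → νH Sg ⇒ TerminalCoalgebra.ν T
  k̂ T = TerminalCoalgebra.unfold T (ε (νH Sg) ∘ₛ τ′ Sg)

  module _ (p′ : Carrier (Sg 0)) (I : InitialAlgebra F) where
    open InitialAlgebra I

    h : FiniteTree Sg → Carrier μ
    h (node {n} σ ss) = φ ⟨$⟩ (ε μ ⟨$⟩ (n , σ , λ i → h (ss i)))

    _∼_ : Rel (FiniteTree Sg) ℓ
    s ∼ s′ = Setoid._≈_ μ (h s) (h s′)

    _∼*_ : Rel (Tree Sg) ℓ
    s ∼* s′ = ∀ n → ∂′ Sg p′ n s ∼ ∂′ Sg p′ n s′

    -- x ≤ y in the order by cutting
    CutBelow : (T : TerminalCoalgebra F) → Rel (Carrier (TerminalCoalgebra.ν T)) ℓ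
    CutBelow T x y =
      x ≈ y ⊎
      ∃[ s ] ∃[ s′ ] ∃[ n ] (x ≈ (k̂ T ⟨$⟩ s) × y ≈ (k̂ T ⟨$⟩ s′) × s ∼* ⌈_⌉ Sg (∂′ Sg p′ n s′))
      where open Setoid (TerminalCoalgebra.ν T) using (_≈_)

------------------------------------------------------------------------
-- Directed joins and conservative completions

module _ (P : Poset ℓ ℓ ℓ) where
  open Poset P using (_≤_) renaming (Carrier to ∣P∣)

  -- Directed subsets are presented as (the images of) directed families.
  IsDirected : {D : Set ℓ} → (D → ∣P∣) → Set ℓ
  IsDirected {D} d = D × (∀ i j → ∃[ k ] (d i ≤ d k × d j ≤ d k))

  IsJoin : {D : Set ℓ} → (D → ∣P∣) → ∣P∣ → Set ℓ
  IsJoin d x = (∀ i → d i ≤ x) × (∀ y → (∀ i → d i ≤ y) → x ≤ y)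

  IsCpo : Set (lsuc ℓ)
  IsCpo = {D : Set ℓ} (d : D → ∣P∣) → IsDirected d → ∃[ x ] IsJoin d x

module _ (P Q : Poset ℓ ℓ ℓ) where
  private
    module P = Poset P
    module Q = Poset Q

  record IsContinuous (f : P.Carrier → Q.Carrier) : Set (lsuc ℓ) where
    field
      monotone      : IsOrderHomomorphism P._≈_ Q._≈_ P._≤_ Q._≤_ f
      preservesJoin : {D : Set ℓ} (d : D → P.Carrier) → IsDirected P d →
                      ∀ x → IsJoin P d x → IsJoin Q (λ i → f (d i)) (f x)

module _ (P P̄ : Poset ℓ ℓ ℓ) where
  private
    module P = Poset P
    module P̄ = Poset P̄

  -- P is viewed as a subposet of P̄ along e.  Closure under existing directed
  -- joins means that a directed join which exists in P is also the join in P̄.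
  record IsConservativeCompletion (e : P.Carrier → P̄.Carrier) : Set (lsuc ℓ) where
    field
      isCpo     : IsCpo P̄
      embedding : IsOrderMonomorphism P._≈_ P̄._≈_ P._≤_ P̄._≤_ e
      closed    : {D : Set ℓ} (d : D → P.Carrier) → IsDirected P d →
                  ∀ x → IsJoin P d x → IsJoin P̄ (λ i → e (d i)) (e x)
      extension : (Q : Poset ℓ ℓ ℓ) → IsCpo Q → let open Poset Q using (_≈_) in
                  (f : P.Carrier → Poset.Carrier Q) → IsContinuous P Q f →
                  Σ[ f̄ ∈ (P̄.Carrier → Poset.Carrier Q) ]
                    IsContinuous P̄ Q f̄ ×
                    (∀ x → f̄ (e x) ≈ f x) ×
                    (∀ g → IsContinuous P̄ Q g → (∀ x → g (e x) ≈ f x) → ∀ y → g y ≈ f̄ y)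

setoidPoset : (A : Setoid ℓ ℓ) (_≤_ : Rel (Carrier A) ℓ) → IsPartialOrder (Setoid._≈_ A) _≤_ → Poset ℓ ℓ ℓ
setoidPoset A _≤_ po = record { Carrier = Carrier A ; _≈_ = Setoid._≈_ A ; _≤_ = _≤_ ; isPartialOrder = po }

-- The order x ≤ y :⇔ f x ≤ f y on A, for an injective map f into a poset.
inducedPoset : {A B : Setoid ℓ ℓ} (f : A ⇒ B) → Injective (Setoid._≈_ A) (Setoid._≈_ B) (to f) →
               {_≤_ : Rel (Carrier B) ℓ} → IsPartialOrder (Setoid._≈_ B) _≤_ → Poset ℓ ℓ ℓ
inducedPoset {A = A} {B} f f-injective {_≤_} po =
  setoidPoset A (_≤_ on to f) (pullBackPartialOrder isMono po)
  where
  isMono : IsOrderMonomorphism (Setoid._≈_ A) (Setoid._≈_ B) (_≤_ on to f) _≤_ (to f)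
  isMono = record
    { isOrderHomomorphism = record { cong = cong f ; mono = λ x≤y → x≤y }
    ; injective           = f-injective
    ; cancel              = λ x≤y → x≤y
    }

OrderIso : (P Q : Poset ℓ ℓ ℓ) → (Poset.Carrier P → Poset.Carrier Q) → Set ℓ
OrderIso P Q = IsOrderIsomorphism (Poset._≈_ P) (Poset._≈_ Q) (Poset._≤_ P) (Poset._≤_ Q)

φ-injective : {F : SetFunctor ℓ} (I : InitialAlgebra F) → let open InitialAlgebra I in
              Injective (Setoid._≈_ (F₀ F μ)) (Setoid._≈_ μ) (to φ)
φ-injective {F = F} I φx≈φy = trans (sym (φ⁻¹φ _)) (trans (cong φ⁻¹ φx≈φy) (φ⁻¹φ _))
  where
  open InitialAlgebra I
  open Setoid (F₀ F μ)

τ⁻¹-injective : {F : SetFunctor ℓ} (T : TerminalCoalgebra F) → let open TerminalCoalgebra T in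
                Injective (Setoid._≈_ (F₀ F ν)) (Setoid._≈_ ν) (to τ⁻¹)
τ⁻¹-injective {F = F} T e = trans (sym (ττ⁻¹ _)) (trans (cong τ e) (ττ⁻¹ _))
  where
  open TerminalCoalgebra T
  open Setoid (F₀ F ν)

-- Put ρ n = inj (suc n) ∘ p^ n : Fⁿ1 → μF and ∂ n = ρ n ∘ c^ n : νF → μF, so that r n = ū ∘ ρ n ∘ proj n.
-- Since ρ (suc n) = φ ∘ F (ρ n), an induction gives c^ n ∘ m ∘ ρ n = id, whence the r n are idempotent
-- and r n ∘ r k = r (min n k).  Every x in μF is fixed by ∂ n ∘ m for large n; this makes m injective
-- and forces ū = c ∘ m.  On trees, h (∂′ n s) = ∂ n (k̂ s), so x ≤ y means x = y or x = m (∂ n y) for some n,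
-- which c turns into ⊑.
--
-- For ⊑, a directed family either has a greatest element or, for every n, a member not fixed by r n.
-- In the second case each coordinate is eventually constant, so the family has exactly one upper bound.
-- Hence every element is the join of its cuts, which lie in the image of μF, and a continuous map is
-- extended by the joins of its values at cuts.
module Submission where

open import Level using (Level; Lift; lift)
open import Axiom.ExcludedMiddle using (ExcludedMiddle)
open import Data.Fin.Base using (Fin; zero; suc; toℕ; fromℕ<; _↑ˡ_; _↑ʳ_)
open import Data.Fin.Properties using (toℕ<n; fromℕ<-toℕ)
open import Data.List.Base using (List; []; _∷_; _∷ʳ_)
open import Data.Maybe using (Maybe; just; nothing; Is-just)
import Data.Maybe.Relation.Binary.Pointwise as Maybe
open import Data.Maybe.Relation.Unary.Any using (just)
open import Data.Nat.Base using (ℕ; zero; suc; _+_; _≤_; _<_; z≤n; s≤s; _⊔_; _≤′_; ≤′-reflexive; ≤′-step)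
open import Data.Nat.Properties using (≤-refl; ≤-total; ≤-trans; _<?_; ≮⇒≥; m≤m⊔n; m≤n⊔m; n≤1+n; ≤⇒≤′)
open import Data.Product.Base using (Σ; Σ-syntax; ∃-syntax; _×_; _,_; proj₁; proj₂)
open import Data.Sum.Base using (_⊎_; inj₁; inj₂)
open import Data.Vec.Functional using (_++_)
open import Data.Vec.Functional.Properties using (lookup-++ˡ; lookup-++ʳ)
open import Function.Bundles using (Func; _⟨$⟩_; _⇔_; mk⇔; module Equivalence)
open import Function.Definitions using (Injective)
open import Relation.Binary.Bundles using (Setoid; Poset)
open import Relation.Binary.Core using (Rel)
open import Relation.Binary.Morphism.Structures using (IsOrderHomomorphism; IsOrderMonomorphism; IsOrderIsomorphism)
import Relation.Binary.Morphism.OrderMonomorphism as OrderMonomorphism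
open import Relation.Binary.PropositionalEquality as ≡ using (_≡_)
open import Relation.Binary.Structures using (IsPartialOrder)
import Relation.Binary.Reasoning.Setoid as SetoidReasoning
open import Relation.Nullary.Decidable.Core using (Dec; yes; no; decidable-stable)
open import Relation.Nullary.Negation.Core using (¬_; contradiction)
open import Defs

open Func using (to; cong)
open Setoid using (Carrier)

private
  variable
    ℓ : Level

-- Directed joins

module _ (Q : Poset ℓ ℓ ℓ) where
  open Poset Q renaming (Carrier to ∣Q∣; _≤_ to _⊴_; trans to ⊴-trans)

  IsJoin-unique : {D : Set ℓ} {d d′ : D → ∣Q∣} {x y : ∣Q∣} → (∀ i → d i ≈ d′ i) →
                  IsJoin Q d x → IsJoin Q d′ y → x ≈ y
  IsJoin-unique e (ux , lx) (uy , ly) = antisym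
    (lx _ (λ i → ⊴-trans (reflexive (e i)) (uy i)))
    (ly _ (λ i → ⊴-trans (reflexive (Eq.sym (e i))) (ux i)))

  greatest⇒IsJoin : {D : Set ℓ} (d : D → ∣Q∣) {i : D} → (∀ j → d j ⊴ d i) → IsJoin Q d (d i)
  greatest⇒IsJoin d {i} g = g , (λ y u → u i)

module _ (P Q : Poset ℓ ℓ ℓ) where
  private
    module P = Poset P
    module Q = Poset Q

  mono⇒directed : {f : P.Carrier → Q.Carrier} → IsOrderHomomorphism P._≈_ Q._≈_ P._≤_ Q._≤_ f →
                  {D : Set ℓ} (d : D → P.Carrier) → IsDirected P d → IsDirected Q (λ i → f (d i))
  mono⇒directed hom d (i , dir) = i , λ j k → let l , p , q = dir j k in l , mono p , mono q
    where open IsOrderHomomorphism hom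

  -- An upper bound in `Q` is the image of some `z`, and `z` bounds the original family because `f`
  -- reflects the order.
  orderIso⇒continuous : {f : P.Carrier → Q.Carrier} → OrderIso P Q f → IsContinuous P Q f
  orderIso⇒continuous {f} iso = record
    { monotone      = isOrderHomomorphism
    ; preservesJoin = λ d _ x (ub , lub) →
        (λ i → mono (ub i)) ,
        λ y u → let z , fz≈ = surjective y
                    fz≈y = fz≈ P.Eq.refl
                in Q.trans (mono (lub z (λ i → cancel (Q.trans (u i) (Q.reflexive (Q.Eq.sym fz≈y))))))
                           (Q.reflexive fz≈y)
    } where open IsOrderIsomorphism iso

-- The maps r n on F^ω1 in abstract form, with equality of the n-th coordinates of a
-- and b expressed as cut n a ≈ cut n b.
record CutSystem (L : Setoid ℓ ℓ) : Set ℓ where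
  open Setoid L using (_≈_)
  field
    cut       : ℕ → L ⇒ L
    cut-finer : ∀ {n k} → n ≤ k → ∀ a → (cut n ⟨$⟩ (cut k ⟨$⟩ a)) ≈ (cut n ⟨$⟩ a)
    cut-fixed : ∀ {n k} → n ≤ k → ∀ a → (cut k ⟨$⟩ (cut n ⟨$⟩ a)) ≈ (cut n ⟨$⟩ a)
    separated : ∀ {a b} → (∀ n → (cut n ⟨$⟩ a) ≈ (cut n ⟨$⟩ b)) → a ≈ b
    complete  : (x : ℕ → Carrier L) → (∀ n → (cut n ⟨$⟩ x (suc n)) ≈ (cut n ⟨$⟩ x n)) →
                ∃[ a ] ∀ n → (cut n ⟨$⟩ a) ≈ (cut n ⟨$⟩ x n)

-- The order of a cut system

module CutOrder {L : Setoid ℓ ℓ} (S : CutSystem L) where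
  open CutSystem S
  open Setoid L renaming (Carrier to ∣L∣)
  open SetoidReasoning L

  infix 4 _⊑_

  _⊑_ : Rel ∣L∣ ℓ
  a ⊑ b = a ≈ b ⊎ ∃[ n ] a ≈ (cut n ⟨$⟩ b)

  cut-⊑ : ∀ n a → (cut n ⟨$⟩ a) ⊑ a
  cut-⊑ n a = inj₂ (n , refl)

  -- Both sides are the cut at the smaller of the two levels.
  cut-commute : ∀ n k a → (cut n ⟨$⟩ (cut k ⟨$⟩ a)) ≈ (cut k ⟨$⟩ (cut n ⟨$⟩ a))
  cut-commute n k a with ≤-total n k
  ... | inj₁ n≤k = trans (cut-finer n≤k a) (sym (cut-fixed n≤k a))
  ... | inj₂ k≤n = trans (cut-fixed k≤n a) (sym (cut-finer k≤n a))

  cut-mono : ∀ n {a b} → a ⊑ b → (cut n ⟨$⟩ a) ⊑ (cut n ⟨$⟩ b)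
  cut-mono n (inj₁ a≈b) = inj₁ (cong (cut n) a≈b)
  cut-mono n {b = b} (inj₂ (k , a≈)) = inj₂ (k , trans (cong (cut n) a≈) (cut-commute n k b))

  cut-coarser : ∀ {n k a b} → n ≤ k → (cut k ⟨$⟩ a) ≈ (cut k ⟨$⟩ b) → (cut n ⟨$⟩ a) ≈ (cut n ⟨$⟩ b)
  cut-coarser {n} n≤k e = trans (sym (cut-finer n≤k _)) (trans (cong (cut n) e) (cut-finer n≤k _))

  ⊑-trans : ∀ {a b e} → a ⊑ b → b ⊑ e → a ⊑ e
  ⊑-trans (inj₁ a≈b) (inj₁ b≈e) = inj₁ (trans a≈b b≈e)
  ⊑-trans (inj₁ a≈b) (inj₂ (n , b≈)) = inj₂ (n , trans a≈b b≈)
  ⊑-trans (inj₂ (n , a≈)) (inj₁ b≈e) = inj₂ (n , trans a≈ (cong (cut n) b≈e))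
  ⊑-trans {e = e} (inj₂ (n , a≈)) (inj₂ (k , b≈)) with ≤-total n k
  ... | inj₁ n≤k = inj₂ (n , trans a≈ (trans (cong (cut n) b≈) (cut-finer n≤k e)))
  ... | inj₂ k≤n = inj₂ (k , trans a≈ (trans (cong (cut n) b≈) (cut-fixed k≤n e)))

  ⊑-antisym : ∀ {a b} → a ⊑ b → b ⊑ a → a ≈ b
  ⊑-antisym (inj₁ a≈b) _ = a≈b
  ⊑-antisym (inj₂ _) (inj₁ b≈a) = sym b≈a
  ⊑-antisym {a} {b} (inj₂ (n , a≈)) (inj₂ (k , b≈)) with ≤-total n k
  -- Here `a`, being a cut at level `n`, is fixed by the finer `cut k`, which also sends it to `b`.
  ... | inj₁ n≤k = begin
    a                           ≈⟨ a≈ ⟩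
    cut n ⟨$⟩ b                 ≈⟨ cut-fixed n≤k b ⟨
    cut k ⟨$⟩ (cut n ⟨$⟩ b)     ≈⟨ cong (cut k) a≈ ⟨
    cut k ⟨$⟩ a                 ≈⟨ b≈ ⟨
    b                           ∎
  ... | inj₂ k≤n = begin
    a                           ≈⟨ a≈ ⟩
    cut n ⟨$⟩ b                 ≈⟨ cong (cut n) b≈ ⟩
    cut n ⟨$⟩ (cut k ⟨$⟩ a)     ≈⟨ cut-fixed k≤n a ⟩
    cut k ⟨$⟩ a                 ≈⟨ b≈ ⟨
    b                           ∎

  ⊑-isPartialOrder : IsPartialOrder _≈_ _⊑_
  ⊑-isPartialOrder = record
    { isPreorder = record { isEquivalence = isEquivalence ; reflexive = inj₁ ; trans = ⊑-trans }
    ; antisym    = ⊑-antisym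
    }

  cutPoset : Poset ℓ ℓ ℓ
  cutPoset = setoidPoset L _⊑_ ⊑-isPartialOrder

  -- An element fixed by `cut l` is fixed by all finer cuts, so for positive `n` this says that the
  -- cut at level `n - 1` moves `b`; quantifying over all `l < n` makes level 0 vacuous.
  Beyond : ℕ → ∣L∣ → Set ℓ
  Beyond n b = ∀ {l} → l < n → ¬ ((cut l ⟨$⟩ b) ≈ b)

  -- If `a` is the cut of `b` at level `l`, then `cut l` fixes `a`; being beyond `n` forces `l ≥ n`,
  -- so `cut n` cannot tell `a` from `b`.
  beyond⇒cut≈ : ∀ {n a b} → Beyond n a → a ⊑ b → (cut n ⟨$⟩ a) ≈ (cut n ⟨$⟩ b)
  beyond⇒cut≈ {n} far (inj₁ a≈b) = cong (cut n) a≈b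
  beyond⇒cut≈ {n} {a} {b} far (inj₂ (l , a≈)) with l <? n
  ... | yes l<n = contradiction
          (trans (cong (cut l) a≈) (trans (cut-fixed ≤-refl b) (sym a≈))) (far l<n)
  ... | no  l≮n = trans (cong (cut n) a≈) (cut-finer (≮⇒≥ l≮n) b)

  module _ {D : Set ℓ} {d : D → ∣L∣} (dir : IsDirected cutPoset d) (far : ∀ n → ∃[ i ] Beyond n (d i)) where

    private
      top : ℕ → D
      top n = proj₁ (far n)

      upper : ∀ i j → ∃[ k ] (d i ⊑ d k × d j ⊑ d k)
      upper = proj₂ dir

      stable : ∀ n {y} → d (top n) ⊑ y → (cut n ⟨$⟩ d (top n)) ≈ (cut n ⟨$⟩ y)
      stable n = beyond⇒cut≈ (proj₂ (far n))

    upperBound-cut : ∀ {y} → (∀ i → d i ⊑ y) → ∀ n → (cut n ⟨$⟩ y) ≈ (cut n ⟨$⟩ d (top n))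
    upperBound-cut u n = sym (stable n (u (top n)))

    upperBound-unique : ∀ {x y} → (∀ i → d i ⊑ x) → (∀ i → d i ⊑ y) → x ≈ y
    upperBound-unique ux uy = separated (λ n → trans (upperBound-cut ux n) (sym (upperBound-cut uy n)))

    private
      cut-compatible : ∀ n → (cut n ⟨$⟩ d (top (suc n))) ≈ (cut n ⟨$⟩ d (top n))
      cut-compatible n = let k , p , q = upper (top n) (top (suc n)) in
        trans (cut-coarser (n≤1+n n) (stable (suc n) q)) (sym (stable n p))

    -- Only a candidate at this stage; that it lies above the whole family is shown in
    -- `beyond⇒IsJoin`.
    upperBound : ∣L∣
    upperBound = proj₁ (complete (λ n → d (top n)) cut-compatible)

    upperBound-cuts : ∀ n → (cut n ⟨$⟩ upperBound) ≈ (cut n ⟨$⟩ d (top n))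
    upperBound-cuts = proj₂ (complete (λ n → d (top n)) cut-compatible)

    -- A common upper bound of `d j` and `d (top n)` has the same cut at level `n` as the candidate.
    cut⊑upperBound : ∀ n {j} → (cut n ⟨$⟩ d j) ⊑ upperBound
    cut⊑upperBound n {j} = let k , p , q = upper j (top n) in
      ⊑-trans (cut-mono n p)
        (⊑-trans (inj₁ (trans (sym (stable n q)) (sym (upperBound-cuts n)))) (cut-⊑ n upperBound))

  -- Directed joins in the order of a cut system

  module _ (em : ExcludedMiddle ℓ) where

    -- If all members were fixed by cut n, a member beyond n would be greatest.
    greatest⊎beyond : {D : Set ℓ} (d : D → ∣L∣) → IsDirected cutPoset d →
                      (∃[ i ] ∀ j → d j ⊑ d i) ⊎ (∀ n → ∃[ i ] Beyond n (d i))
    greatest⊎beyond {D} d (i₀ , upper) with em {∃[ i ] ∀ j → d j ⊑ d i}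
    ... | yes g  = inj₁ g
    ... | no  ¬g = inj₂ climb
      where
      climb : ∀ n → ∃[ i ] Beyond n (d i)
      climb zero = i₀ , λ ()
      climb (suc n) with em {∃[ j ] ¬ ((cut n ⟨$⟩ d j) ≈ d j)}
      -- An element fixed by `cut l` with `l ≤ n` is fixed by `cut n`, so a member moved by `cut n`
      -- is beyond `suc n`.
      ... | yes (j , moves) = j , λ { (s≤s l≤n) fixed → moves
              (trans (cong (cut n) (sym fixed)) (trans (cut-fixed l≤n (d j)) fixed)) }
      ... | no  ¬moves = contradiction (i , λ j → let k , p , q = upper i j in ⊑-trans q (inj₁ (above k p))) ¬g
        where
        i : D
        i = proj₁ (climb n)

        fixed : ∀ j → (cut n ⟨$⟩ d j) ≈ d j
        fixed j = decidable-stable em (λ moves → ¬moves (j , moves))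

        above : ∀ k → d i ⊑ d k → d k ≈ d i
        above k p = trans (sym (fixed k)) (trans (sym (beyond⇒cut≈ (proj₂ (climb n)) p)) (fixed i))

    -- Upper bounds are unique here, so only `below` needs work.
    beyond⇒IsJoin : {D : Set ℓ} (d : D → ∣L∣) → IsDirected cutPoset d → (∀ n → ∃[ i ] Beyond n (d i)) →
                    ∃[ x ] IsJoin cutPoset d x
    beyond⇒IsJoin d dir far = x , below , λ y u → inj₁ (upperBound-unique dir far below u)
      where
      x : ∣L∣
      x = upperBound dir far

      below : ∀ j → d j ⊑ x
      below j with em {∃[ n ] (cut n ⟨$⟩ d j) ≈ d j}
      -- A member fixed by some cut equals that cut of itself; a member moved by all cuts is beyond
      -- every level and is therefore `x` itself.
      ... | yes (n , fixed) = ⊑-trans (inj₁ (sym fixed)) (cut⊑upperBound dir far n)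
      ... | no  ¬fixed = inj₁ (separated (λ n →
              let k , p , q = proj₂ dir j (proj₁ (far n)) in
              trans (beyond⇒cut≈ (λ _ e → ¬fixed (_ , e)) p)
                (trans (sym (beyond⇒cut≈ (proj₂ (far n)) q))
                       (sym (upperBound-cuts dir far n)))))

    ⊑-isCpo : IsCpo cutPoset
    ⊑-isCpo d dir with greatest⊎beyond d dir
    ... | inj₁ (i , g) = d i , greatest⇒IsJoin cutPoset d g
    ... | inj₂ far     = beyond⇒IsJoin d dir far

    -- The index is lifted to the universe in which directed families are indexed.
    cutChain : ∣L∣ → Lift ℓ ℕ → ∣L∣
    cutChain a (lift n) = cut n ⟨$⟩ a

    cutChain-directed : ∀ a → IsDirected cutPoset (cutChain a)
    cutChain-directed a = lift 0 , λ { (lift n) (lift k) → lift (n ⊔ k) ,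
      inj₂ (n , sym (cut-finer (m≤m⊔n n k) a)) , inj₂ (k , sym (cut-finer (m≤n⊔m n k) a)) }

    -- If the chain has a greatest element, that element has the same cuts as `a` and so is `a`;
    -- otherwise the chain has a unique upper bound.
    cutChain-IsJoin : ∀ a → IsJoin cutPoset (cutChain a) a
    cutChain-IsJoin a = below , least
      where
      below : ∀ i → cutChain a i ⊑ a
      below (lift n) = cut-⊑ n a

      least : ∀ y → (∀ i → cutChain a i ⊑ y) → a ⊑ y
      least y u with greatest⊎beyond (cutChain a) (cutChain-directed a)
      ... | inj₂ far = inj₁ (upperBound-unique (cutChain-directed a) far below u)
      ... | inj₁ (lift k , g) = ⊑-trans (inj₁ (sym (separated cut≈))) (u (lift k))
        where
        cut≈ : ∀ n → (cut n ⟨$⟩ (cut k ⟨$⟩ a)) ≈ (cut n ⟨$⟩ a)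
        cut≈ n with ≤-total n k
        ... | inj₁ n≤k = cut-finer n≤k a
        ... | inj₂ k≤n = trans (cut-fixed k≤n a)
                (⊑-antisym (inj₂ (k , sym (cut-finer k≤n a))) (g (lift n)))

    -- Subposets containing every cut, and their conservative completion

    module _ (P : Poset ℓ ℓ ℓ) (e : Poset.Carrier P → ∣L∣)
             (e-mono : IsOrderMonomorphism (Poset._≈_ P) _≈_ (Poset._≤_ P) _⊑_ e)
             (s : ℕ → ∣L∣ → Poset.Carrier P)
             (e-s : ∀ n a → e (s n a) ≈ (cut n ⟨$⟩ a)) where
      private
        module P = Poset P
        module E = IsOrderMonomorphism e-mono

      IsJoin-reflected : {D : Set ℓ} {d : D → P.Carrier} {x : P.Carrier} →
                         IsJoin cutPoset (λ i → e (d i)) (e x) → IsJoin P d x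
      IsJoin-reflected (u , l) = (λ i → E.cancel (u i)) , λ y v → E.cancel (l (e y) (λ i → E.mono (v i)))

      -- In the first case of the dichotomy the join in `P` is below the greatest member; in the
      -- second `e x` is the only upper bound.
      IsJoin-preserved : {D : Set ℓ} (d : D → P.Carrier) → IsDirected P d → ∀ x →
                         IsJoin P d x → IsJoin cutPoset (λ i → e (d i)) (e x)
      IsJoin-preserved d dir x (u , l) = (λ i → E.mono (u i)) , least
        where
        e-dir : IsDirected cutPoset (λ i → e (d i))
        e-dir = mono⇒directed P cutPoset E.isOrderHomomorphism d dir

        least : ∀ y → (∀ i → e (d i) ⊑ y) → e x ⊑ y
        least y v with greatest⊎beyond (λ i → e (d i)) e-dir
        ... | inj₁ (i , g) = ⊑-trans (E.mono (l (d i) (λ j → E.cancel (g j)))) (v i)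
        ... | inj₂ far     = inj₁ (upperBound-unique e-dir far (λ i → E.mono (u i)) v)

      cuts : ∣L∣ → Lift ℓ ℕ → P.Carrier
      cuts a (lift n) = s n a

      s-mono : ∀ n {a b} → a ⊑ b → s n a P.≤ s n b
      s-mono n {a} {b} a⊑b = E.cancel
        (⊑-trans (inj₁ (e-s n a)) (⊑-trans (cut-mono n a⊑b) (inj₁ (sym (e-s n b)))))

      cuts-directed : ∀ a → IsDirected P (cuts a)
      cuts-directed a = lift 0 , λ { i@(lift n) j@(lift k) →
        let l , p , q = proj₂ (cutChain-directed a) i j in
        l , E.cancel (⊑-trans (inj₁ (e-s n a)) (⊑-trans p (inj₁ (sym (e-s _ a))))) ,
            E.cancel (⊑-trans (inj₁ (e-s k a)) (⊑-trans q (inj₁ (sym (e-s _ a))))) }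

      e-cuts-IsJoin : ∀ a → IsJoin cutPoset (λ i → e (cuts a i)) a
      e-cuts-IsJoin a =
        (λ { (lift n) → ⊑-trans (inj₁ (e-s n a)) (cut-⊑ n a) }) ,
        λ y u → proj₂ (cutChain-IsJoin a) y
                  (λ { (lift n) → ⊑-trans (inj₁ (sym (e-s n a))) (u (lift n)) })

      cuts-IsJoin : ∀ x → IsJoin P (cuts (e x)) x
      cuts-IsJoin x = IsJoin-reflected (e-cuts-IsJoin (e x))

      -- Every `x` is the directed join of its cuts `s n (e x)`, so a continuous map is determined
      -- by its values on cuts.
      continuous-ext : (Q : Poset ℓ ℓ ℓ) {g g′ : P.Carrier → Poset.Carrier Q} →
                       IsContinuous P Q g → IsContinuous P Q g′ →
                       (∀ n a → Poset._≈_ Q (g (s n a)) (g′ (s n a))) →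
                       ∀ x → Poset._≈_ Q (g x) (g′ x)
      continuous-ext Q cont cont′ agree x = IsJoin-unique Q (λ { (lift n) → agree n (e x) })
        (IsContinuous.preservesJoin cont (cuts (e x)) (cuts-directed (e x)) x (cuts-IsJoin x))
        (IsContinuous.preservesJoin cont′ (cuts (e x)) (cuts-directed (e x)) x (cuts-IsJoin x))

      module Extension (Q : Poset ℓ ℓ ℓ) (Q-cpo : IsCpo Q)
                       {f : P.Carrier → Poset.Carrier Q} (f-continuous : IsContinuous P Q f) where
        private
          module Q = Poset Q
          module f = IsContinuous f-continuous

        f-cuts : ∣L∣ → Lift ℓ ℕ → Q.Carrier
        f-cuts a i = f (cuts a i)

        f-cuts-directed : ∀ a → IsDirected Q (f-cuts a)
        f-cuts-directed a = mono⇒directed P Q f.monotone (cuts a) (cuts-directed a)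

        f̄ : ∣L∣ → Q.Carrier
        f̄ a = proj₁ (Q-cpo (f-cuts a) (f-cuts-directed a))

        f̄-IsJoin : ∀ a → IsJoin Q (f-cuts a) (f̄ a)
        f̄-IsJoin a = proj₂ (Q-cpo (f-cuts a) (f-cuts-directed a))

        f-s-mono : ∀ n {a b} → a ⊑ b → f (s n a) Q.≤ f (s n b)
        f-s-mono n p = IsOrderHomomorphism.mono f.monotone (s-mono n p)

        f̄-mono : ∀ {a b} → a ⊑ b → f̄ a Q.≤ f̄ b
        f̄-mono {a} {b} a⊑b = proj₂ (f̄-IsJoin a) (f̄ b)
          (λ { (lift n) → Q.trans (f-s-mono n a⊑b) (proj₁ (f̄-IsJoin b) (lift n)) })

        f̄-preservesJoin : {D : Set ℓ} (d : D → ∣L∣) → IsDirected cutPoset d →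
                          ∀ x → IsJoin cutPoset d x → IsJoin Q (λ i → f̄ (d i)) (f̄ x)
        f̄-preservesJoin d dir x (u , l) = (λ i → f̄-mono (u i)) , least
          where
          least : ∀ y → (∀ i → f̄ (d i) Q.≤ y) → f̄ x Q.≤ y
          least y v with greatest⊎beyond d dir
          ... | inj₁ (i , g) = Q.trans (f̄-mono (l (d i) g)) (v i)
          -- A member `d i` beyond `n` has the same cut at level `n` as `x`, so the corresponding
          -- term of the join defining `f̄ x` is already below `f̄ (d i)`.
          ... | inj₂ far     = proj₂ (f̄-IsJoin x) y (λ { (lift n) →
                  let i  = proj₁ (far n)
                      e≈ = trans (e-s n x) (trans (upperBound-cut dir far u n) (sym (e-s n (d i))))
                      s≈ = E.cancel (inj₁ e≈)
                  in Q.trans (IsOrderHomomorphism.mono f.monotone s≈)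
                       (Q.trans (proj₁ (f̄-IsJoin (d i)) (lift n)) (v i)) })

        f̄-continuous : IsContinuous cutPoset Q f̄
        f̄-continuous = record
          { monotone      = record
            { cong = λ a≈b → Q.antisym (f̄-mono (inj₁ a≈b)) (f̄-mono (inj₁ (sym a≈b)))
            ; mono = f̄-mono
            }
          ; preservesJoin = f̄-preservesJoin
          }

        f̄-extends : ∀ x → f̄ (e x) Q.≈ f x
        f̄-extends x = IsJoin-unique Q (λ _ → Q.Eq.refl) (f̄-IsJoin (e x))
          (f.preservesJoin (cuts (e x)) (cuts-directed (e x)) x (cuts-IsJoin x))

        -- Even outside the image of `e`, `y` is the directed join of its cuts, and those are images
        -- of points of `P`.
        f̄-unique : ∀ g → IsContinuous cutPoset Q g → (∀ x → g (e x) Q.≈ f x) → ∀ y → g y Q.≈ f̄ y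
        f̄-unique g g-continuous g-extends y = IsJoin-unique Q (λ i → g-extends (cuts y i))
          (IsContinuous.preservesJoin g-continuous (λ i → e (cuts y i))
            (mono⇒directed P cutPoset E.isOrderHomomorphism (cuts y) (cuts-directed y))
            y (e-cuts-IsJoin y))
          (f̄-IsJoin y)

      isConservativeCompletion : IsConservativeCompletion P cutPoset e
      isConservativeCompletion = record
        { isCpo     = ⊑-isCpo
        ; embedding = e-mono
        ; closed    = IsJoin-preserved
        ; extension = λ Q Q-cpo f f-continuous →
            let open Extension Q Q-cpo f-continuous in f̄ , f̄-continuous , f̄-extends , f̄-unique
        }

-- Presentations

-- The maximum of finitely many thresholds serves all indices; finiteness of arities enters through
-- this.
∃-uniform : ∀ {n} {p} {Q : Fin n → ℕ → Set p} → (∀ i → ∃[ N ] ∀ {k} → N ≤ k → Q i k) →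
            ∃[ N ] ∀ i {k} → N ≤ k → Q i k
∃-uniform {zero}  _ = 0 , λ ()
∃-uniform {suc n} q with q zero | ∃-uniform (λ i → q (suc i))
... | N , q₀ | M , qₛ = N ⊔ M , λ
  { zero    N⊔M≤k → q₀ (≤-trans (m≤m⊔n N M) N⊔M≤k)
  ; (suc i) N⊔M≤k → qₛ i (≤-trans (m≤n⊔m N M) N⊔M≤k)
  }

-- The last hypothesis makes the assignment of `a i` to `b i` well defined; points outside the
-- family go to the given element of `A`.
extendAlong : ExcludedMiddle ℓ → (A B : Setoid ℓ ℓ) → Carrier A →
              ∀ {n} (a : Fin n → Carrier A) (b : Fin n → Carrier B) →
              (∀ i j → Setoid._≈_ B (b i) (b j) → Setoid._≈_ A (a i) (a j)) →
              Σ[ f ∈ B ⇒ A ] ∀ i → Setoid._≈_ A (f ⟨$⟩ b i) (a i)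
extendAlong em A B a₀ {n} a b inj = record { to = λ y → value y em ; cong = value-cong em em } , λ i → value-b i em
  where
  module A = Setoid A
  module B = Setoid B

  -- The decision is an explicit argument, so that congruence can compare two independent decisions.
  value : ∀ y → Dec (∃[ i ] b i B.≈ y) → A.Carrier
  value y (yes (i , _)) = a i
  value y (no _)        = a₀

  value-cong : ∀ {y z} (p : Dec (∃[ i ] b i B.≈ y)) (q : Dec (∃[ i ] b i B.≈ z)) → y B.≈ z → value y p A.≈ value z q
  value-cong (yes (i , p)) (yes (j , q)) y≈z = inj i j (B.trans p (B.trans y≈z (B.sym q)))
  value-cong (yes (i , p)) (no ¬q)       y≈z = contradiction (i , B.trans p y≈z) ¬q
  value-cong (no ¬p)       (yes (j , q)) y≈z = contradiction (j , B.trans q (B.sym y≈z)) ¬p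
  value-cong (no _)        (no _)        y≈z = A.refl

  value-b : ∀ i (p : Dec (∃[ j ] b j B.≈ b i)) → value (b i) p A.≈ a i
  value-b i (yes (j , p)) = inj j i p
  value-b i (no ¬p)       = contradiction (i , B.refl) ¬p

module _ (F : SetFunctor ℓ) where
  open SetFunctor F

  F-fuse : {A B C : Setoid ℓ ℓ} (g : B ⇒ C) (f : A ⇒ B) (e : A ⇒ C) → g ∘ₛ f ≋ e → F₁ g ∘ₛ F₁ f ≋ F₁ e
  F-fuse {C = C} g f e eq x = Setoid.trans (F₀ C) (Setoid.sym (F₀ C) (F-∘ g f x)) (F-resp-≋ {f = g ∘ₛ f} {e} eq x)

module _ {F : SetFunctor ℓ} {Sg : Signature ℓ} (P : Presentation F Sg) where
  open SetFunctor F
  open Presentation P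

  presented : (X : Setoid ℓ ℓ) → Carrier (F₀ X) → Flat Sg (Carrier X)
  presented X a = proj₁ (surjective X a)

  ε-presented : (X : Setoid ℓ ℓ) → ∀ a → Setoid._≈_ (F₀ X) (ε X ⟨$⟩ presented X a) a
  ε-presented X a = proj₂ (surjective X a) (Setoid.refl (flatSetoid Sg X))

  module _ (I : InitialAlgebra F) where
    open InitialAlgebra I
    private module M = Setoid μ

    -- The elements satisfying `Q` carry an algebra structure; folding into it and then including in
    -- `μ` is an algebra endomorphism, hence the identity.
    μ-induction : (Q : M.Carrier → Set ℓ) → (∀ {x y} → x M.≈ y → Q x → Q y) →
                  (∀ {n} (σ : Carrier (Sg n)) xs → (∀ i → Q (xs i)) → Q (φ ⟨$⟩ (ε μ ⟨$⟩ (n , σ , xs)))) →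
                  ∀ x → Q x
    μ-induction Q Q-resp step x = Q-resp (incl-fold x) (proj₂ (fold alg ⟨$⟩ x))
      where
      S : Setoid ℓ ℓ
      S = record
        { Carrier       = Σ M.Carrier Q
        ; _≈_           = λ a b → proj₁ a M.≈ proj₁ b
        ; isEquivalence = record { refl = M.refl ; sym = M.sym ; trans = M.trans }
        }

      incl : S ⇒ μ
      incl = record { to = proj₁ ; cong = λ e → e }

      alg-Q : ∀ a → Q (φ ⟨$⟩ (F₁ incl ⟨$⟩ a))
      alg-Q a = let n , σ , ys = presented S a in
        Q-resp (cong φ (Setoid.trans (F₀ μ) (Setoid.sym (F₀ μ) (natural incl (n , σ , ys)))
                                            (cong (F₁ incl) (ε-presented S a))))
               (step σ (λ i → proj₁ (ys i)) (λ i → proj₂ (ys i)))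

      alg : F₀ S ⇒ S
      alg = record { to = λ a → (φ ⟨$⟩ (F₁ incl ⟨$⟩ a)) , alg-Q a ; cong = λ e → cong φ (cong (F₁ incl) e) }

      incl-fold : incl ∘ₛ fold alg ≋ idₛ μ
      incl-fold y = M.trans
        (fold-unique φ (incl ∘ₛ fold alg)
          (λ a → M.trans (fold-hom alg a) (cong φ (Setoid.sym (F₀ μ) (F-∘ incl (fold alg) a)))) y)
        (M.sym (fold-unique φ (idₛ μ) (λ a → cong φ (Setoid.sym (F₀ μ) (F-id a))) y))

  -- A section of `k̂` from chosen presentations

  module _ (T : TerminalCoalgebra F) where
    open TerminalCoalgebra T
    private module N = Setoid ν

    arityAt : N.Carrier → ℕ
    arityAt x = proj₁ (presented ν (τ ⟨$⟩ x))

    symbolAt : ∀ x → Carrier (Sg (arityAt x))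
    symbolAt x = proj₁ (proj₂ (presented ν (τ ⟨$⟩ x)))

    childAt : ∀ x → Fin (arityAt x) → N.Carrier
    childAt x = proj₂ (proj₂ (presented ν (τ ⟨$⟩ x)))

    labelAt : N.Carrier → List ℕ → Maybe (Symbol Sg)
    labelAt x [] = just (arityAt x , symbolAt x)
    labelAt x (i ∷ w) with i <? arityAt x
    ... | yes i<n = labelAt (childAt x (fromℕ< i<n)) w
    ... | no  _   = nothing

    labelAt-children : ∀ x w i → Is-just (labelAt x (w ∷ʳ i)) ⇔ (i < arity Sg (labelAt x w))
    labelAt-children x [] i with i <? arityAt x
    ... | yes i<n = mk⇔ (λ _ → i<n) (λ _ → just _)
    ... | no  i≮n = mk⇔ (λ ()) (λ i<n → contradiction i<n i≮n)
    labelAt-children x (j ∷ w) i with j <? arityAt x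
    ... | yes j<n = labelAt-children (childAt x (fromℕ< j<n)) w i
    ... | no  _   = mk⇔ (λ ()) (λ ())

    -- Each node carries the symbol of a chosen `ε`-preimage of `τ` at that node; these trees later
    -- serve as representatives in the order by cutting.
    treeAt : N.Carrier → Tree Sg
    treeAt x = record { label = labelAt x ; root = just _ ; children = labelAt-children x }

    labelAt-toℕ : ∀ x (i : Fin (arityAt x)) w → labelAt x (toℕ i ∷ w) ≡ labelAt (childAt x i) w
    labelAt-toℕ x i w with toℕ i <? arityAt x
    ... | yes i<n = ≡.cong (λ j → labelAt (childAt x j) w) (fromℕ<-toℕ i i<n)
    ... | no  i≮n = contradiction (toℕ<n i) i≮n

    -- treeAt need not respect the equality of ν, so k̂ ∘ treeAt is compared with
    -- the identity as coalgebra homomorphisms from the discrete set on ν.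
    k̂-treeAt : ∀ x → (k̂ P T ⟨$⟩ treeAt x) N.≈ x
    k̂-treeAt x = N.trans (unfold-unique coalg (k̂ P T ∘ₛ tree) tree-hom x) (N.sym (unfold-unique coalg quot quot-hom x))
      where
      module FN = Setoid (F₀ ν)
      D : Setoid ℓ ℓ
      D = ≡.setoid N.Carrier

      quot : D ⇒ ν
      quot = record { to = λ y → y ; cong = N.reflexive }

      tree : D ⇒ νH Sg
      tree = record { to = treeAt ; cong = λ { {y} ≡.refl → Setoid.refl (νH Sg) {treeAt y} } }

      coalg : D ⇒ F₀ D
      coalg = record
        { to   = λ y → ε D ⟨$⟩ (arityAt y , symbolAt y , childAt y)
        ; cong = λ { ≡.refl → Setoid.refl (F₀ D) }
        }

      quot-hom : τ ∘ₛ quot ≋ F₁ quot ∘ₛ coalg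
      quot-hom y = FN.trans (FN.sym (ε-presented ν (τ ⟨$⟩ y))) (FN.sym (natural quot _))

      tree-hom : τ ∘ₛ k̂ P T ∘ₛ tree ≋ F₁ (k̂ P T ∘ₛ tree) ∘ₛ coalg
      tree-hom y = begin
        τ ⟨$⟩ (k̂ P T ⟨$⟩ treeAt y)                                              ≈⟨ unfold-hom _ (treeAt y) ⟩
        F₁ (k̂ P T) ⟨$⟩ (ε (νH Sg) ⟨$⟩ untuple Sg (treeAt y))
          ≈⟨ cong (F₁ (k̂ P T)) (cong (ε (νH Sg)) (flat≈ (Setoid.refl (Sg _))
               (λ i w → Setoid.reflexive (Maybe.setoid (symbolSetoid Sg)) (labelAt-toℕ y i w)))) ⟩
        F₁ (k̂ P T) ⟨$⟩ (ε (νH Sg) ⟨$⟩ (arityAt y , symbolAt y , λ i → treeAt (childAt y i)))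
          ≈⟨ cong (F₁ (k̂ P T)) (natural tree _) ⟨
        F₁ (k̂ P T) ⟨$⟩ (F₁ tree ⟨$⟩ (coalg ⟨$⟩ y))                              ≈⟨ F-∘ (k̂ P T) tree (coalg ⟨$⟩ y) ⟨
        F₁ (k̂ P T ∘ₛ tree) ⟨$⟩ (coalg ⟨$⟩ y)                                    ∎
        where
        open SetoidReasoning (F₀ ν)

-- Truncation

-- The connecting maps compute coordinate `n` from coordinate `k`, one step of `≤′` at a time.
proj-coarser : (F : SetFunctor ℓ) (a b : Carrier (F^ω1 F)) → ∀ {n k} → n ≤ k →
               Setoid._≈_ (_^_ F (𝟙 ℓ) k) (proj₁ a k) (proj₁ b k) →
               Setoid._≈_ (_^_ F (𝟙 ℓ) n) (proj₁ a n) (proj₁ b n)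
proj-coarser {ℓ} F a b {n} n≤k = go (≤⇒≤′ n≤k)
  where
  go : ∀ {k} → n ≤′ k → Setoid._≈_ (_^_ F (𝟙 ℓ) k) (proj₁ a k) (proj₁ b k) →
       Setoid._≈_ (_^_ F (𝟙 ℓ) n) (proj₁ a n) (proj₁ b n)
  go (≤′-reflexive ≡.refl) e = e
  go (≤′-step {k} n≤k) e = go n≤k (trans (sym (proj₂ a k)) (trans (cong (t^ F k) e) (proj₂ b k)))
    where open Setoid (_^_ F (𝟙 ℓ) k)

module Truncation {F : SetFunctor ℓ} {Sg : Signature ℓ} (P : Presentation F Sg) (p′ : Carrier (Sg 0))
                  (I : InitialAlgebra F) (T : TerminalCoalgebra F) where
  open SetFunctor F
  open Presentation P
  open InitialAlgebra I
  open TerminalCoalgebra T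
  private
    module M = Setoid μ
    module N = Setoid ν
    module FM = Setoid (F₀ μ)
    module FN = Setoid (F₀ ν)
    module L = Setoid (F^ω1 F)
    module 𝟙^ (n : ℕ) = Setoid (_^_ F (𝟙 ℓ) n)

    mF : μ ⇒ ν
    mF = m F T I

    cF : ν ⇒ F^ω1 F
    cF = c F T

    cₙ : ∀ n → ν ⇒ _^_ F (𝟙 ℓ) n
    cₙ = c^ F T

  ρ : ∀ n → _^_ F (𝟙 ℓ) n ⇒ μ
  ρ n = inj F I (suc n) ∘ₛ p^ F (basePoint P p′) n

  ∂ : ∀ n → ν ⇒ μ
  ∂ n = ρ n ∘ₛ cₙ n

  ρ-suc : ∀ n → ρ (suc n) ≋ φ ∘ₛ F₁ (ρ n)
  ρ-suc n v = cong φ (F-fuse F (inj F I (suc n)) (p^ F (basePoint P p′) n) (ρ n) (λ _ → M.refl) v)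

  ∂-suc : ∀ n → ∂ (suc n) ≋ φ ∘ₛ F₁ (∂ n) ∘ₛ τ
  ∂-suc n x = M.trans (ρ-suc n _) (cong φ (F-fuse F (ρ n) (cₙ n) (∂ n) (λ _ → M.refl) (τ ⟨$⟩ x)))

  τ-m-φ : τ ∘ₛ mF ∘ₛ φ ≋ F₁ mF
  τ-m-φ a = FN.trans (unfold-hom φ⁻¹ (φ ⟨$⟩ a)) (cong (F₁ mF) (φ⁻¹φ a))

  c-suc-φ : ∀ n → cₙ (suc n) ∘ₛ mF ∘ₛ φ ≋ F₁ (cₙ n ∘ₛ mF)
  c-suc-φ n a = trans (cong (F₁ (cₙ n)) (τ-m-φ a)) (F-fuse F (cₙ n) mF (cₙ n ∘ₛ mF) (λ _ → 𝟙^.refl n) a)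
    where open Setoid (_^_ F (𝟙 ℓ) (suc n))

  ∂-suc-φ : ∀ n → ∂ (suc n) ∘ₛ mF ∘ₛ φ ≋ φ ∘ₛ F₁ (∂ n ∘ₛ mF)
  ∂-suc-φ n a = M.trans (∂-suc n _) (cong φ
    (FM.trans (cong (F₁ (∂ n)) (τ-m-φ a)) (F-fuse F (∂ n) mF (∂ n ∘ₛ mF) (λ _ → M.refl) a)))

  -- The recursions of `ρ` and `cₙ ∘ₛ mF` through `φ` cancel, leaving `F` applied to the previous
  -- level.
  c-m-ρ : ∀ n → cₙ n ∘ₛ mF ∘ₛ ρ n ≋ idₛ (_^_ F (𝟙 ℓ) n)
  c-m-ρ zero    v = ≡.refl
  c-m-ρ (suc n) v = begin
    cₙ (suc n) ⟨$⟩ (mF ⟨$⟩ (ρ (suc n) ⟨$⟩ v))             ≈⟨ cong (cₙ (suc n) ∘ₛ mF) (ρ-suc n v) ⟩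
    cₙ (suc n) ⟨$⟩ (mF ⟨$⟩ (φ ⟨$⟩ (F₁ (ρ n) ⟨$⟩ v)))      ≈⟨ c-suc-φ n _ ⟩
    F₁ (cₙ n ∘ₛ mF) ⟨$⟩ (F₁ (ρ n) ⟨$⟩ v)                  ≈⟨ F-fuse F (cₙ n ∘ₛ mF) (ρ n) (idₛ _) (c-m-ρ n) v ⟩
    F₁ (idₛ _) ⟨$⟩ v                                      ≈⟨ F-id v ⟩
    v                                                     ∎
    where open SetoidReasoning (_^_ F (𝟙 ℓ) (suc n))

  ∂-m-ρ : ∀ {n k} → n ≤ k → ∂ k ∘ₛ mF ∘ₛ ρ n ≋ ρ n
  ∂-m-ρ {zero} {zero} z≤n v = M.refl
  -- `ρ 0` is `φ` of the base point pushed along the empty map, so a map applied below the root does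
  -- not affect it.
  ∂-m-ρ {zero} {suc k} z≤n v = M.trans (∂-suc-φ k _)
    (cong φ (F-fuse F (∂ k ∘ₛ mF) (fromEmpty μ) (fromEmpty μ) (λ ()) (basePoint P p′)))
  ∂-m-ρ {suc n} {suc k} (s≤s n≤k) v = begin
    ∂ (suc k) ⟨$⟩ (mF ⟨$⟩ (ρ (suc n) ⟨$⟩ v))              ≈⟨ cong (∂ (suc k) ∘ₛ mF) (ρ-suc n v) ⟩
    ∂ (suc k) ⟨$⟩ (mF ⟨$⟩ (φ ⟨$⟩ (F₁ (ρ n) ⟨$⟩ v)))       ≈⟨ ∂-suc-φ k _ ⟩
    φ ⟨$⟩ (F₁ (∂ k ∘ₛ mF) ⟨$⟩ (F₁ (ρ n) ⟨$⟩ v))           ≈⟨ cong φ (F-fuse F (∂ k ∘ₛ mF) (ρ n) (ρ n) (∂-m-ρ n≤k) v) ⟩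
    φ ⟨$⟩ (F₁ (ρ n) ⟨$⟩ v)                                ≈⟨ ρ-suc n v ⟨
    ρ (suc n) ⟨$⟩ v                                       ∎
    where open SetoidReasoning μ

  -- An operation has finitely many arguments, so by induction one level fixes them all.
  ∂-eventually-fixes : ∀ x → ∃[ N ] ∀ {k} → N ≤ k → (∂ k ⟨$⟩ (mF ⟨$⟩ x)) M.≈ x
  ∂-eventually-fixes = μ-induction P I _
    (λ { x≈y (N , fix) → N , λ {k} N≤k →
           M.trans (cong (∂ k ∘ₛ mF) (M.sym x≈y)) (M.trans (fix N≤k) x≈y) })
    (λ {n} σ xs fixes → let N , fix = ∃-uniform fixes in
       -- The root costs one level more than the arguments.
       suc N , λ { {suc k} (s≤s N≤k) → M.trans (∂-suc-φ k _) (cong φ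
         (FM.trans (natural (∂ k ∘ₛ mF) (n , σ , xs))
                   (cong (ε μ) (flat≈ (Setoid.refl (Sg n)) (λ i → fix i N≤k))))) })

  m-injective : Injective M._≈_ N._≈_ (to mF)
  m-injective {x} {y} e =
    let N , fx = ∂-eventually-fixes x
        K , fy = ∂-eventually-fixes y
    in M.trans (M.sym (fx (m≤m⊔n N K))) (M.trans (cong (∂ (N ⊔ K)) e) (fy (m≤n⊔m N K)))

  -- Together with uniqueness this lets `ū` be replaced by `c ∘ m`.
  c-m-inj : Is-ū F I (cF ∘ₛ mF)
  c-m-inj zero    ()
  c-m-inj (suc n) a = begin
    cₙ (suc n) ⟨$⟩ (mF ⟨$⟩ (φ ⟨$⟩ (F₁ (inj F I n) ⟨$⟩ a)))    ≈⟨ c-suc-φ n _ ⟩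
    F₁ (cₙ n ∘ₛ mF) ⟨$⟩ (F₁ (inj F I n) ⟨$⟩ a)                ≈⟨ F-fuse F (cₙ n ∘ₛ mF) (inj F I n) (u^ F n) (c-m-inj n) a ⟩
    F₁ (u^ F n) ⟨$⟩ a                                         ∎
    where open SetoidReasoning (_^_ F (𝟙 ℓ) (suc n))

  -- Every `x` is in the image of `inj (suc K)` for all large `K`, where the equations determine
  -- coordinate `suc K`; the lower coordinates follow.
  Is-ū-unique : ∀ f g → Is-ū F I f → Is-ū F I g → f ≋ g
  Is-ū-unique f g f-ū g-ū x k =
    proj-coarser F (f ⟨$⟩ x) (g ⟨$⟩ x) (≤-trans (m≤n⊔m N k) (n≤1+n K)) (begin
      proj₁ (f ⟨$⟩ x) (suc K)                            ≈⟨ cong f x≈inj (suc K) ⟩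
      proj₁ (f ⟨$⟩ (inj F I (suc K) ⟨$⟩ y)) (suc K)      ≈⟨ f-ū (suc K) y ⟩
      u^ F (suc K) ⟨$⟩ y                                 ≈⟨ g-ū (suc K) y ⟨
      proj₁ (g ⟨$⟩ (inj F I (suc K) ⟨$⟩ y)) (suc K)      ≈⟨ cong g x≈inj (suc K) ⟨
      proj₁ (g ⟨$⟩ x) (suc K)                            ∎)
    where
    N = proj₁ (∂-eventually-fixes x)
    K = N ⊔ k
    y = p^ F (basePoint P p′) K ⟨$⟩ (cₙ K ⟨$⟩ (mF ⟨$⟩ x))
    x≈inj : x M.≈ (inj F I (suc K) ⟨$⟩ y)
    x≈inj = M.sym (proj₂ (∂-eventually-fixes x) (m≤m⊔n N k))
    open SetoidReasoning (_^_ F (𝟙 ℓ) (suc K))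

  -- Injectivity of `c`, through the quotient of νF by its kernel

  module _ (em : ExcludedMiddle ℓ) where

    private
      _∼c_ : Rel N.Carrier ℓ
      x ∼c y = (cF ⟨$⟩ x) L.≈ (cF ⟨$⟩ y)

      Q : Setoid ℓ ℓ
      Q = record
        { Carrier       = N.Carrier
        ; _≈_           = _∼c_
        ; isEquivalence = record
          { refl  = λ {x} → L.refl {cF ⟨$⟩ x}
          ; sym   = λ {x} {y} → L.sym {cF ⟨$⟩ x} {cF ⟨$⟩ y}
          ; trans = λ {x} {y} {z} → L.trans {cF ⟨$⟩ x} {cF ⟨$⟩ y} {cF ⟨$⟩ z}
          }
        }

      q : ν ⇒ Q
      q = record { to = λ x → x ; cong = cong cF }

    -- Classically, either some level tells `x` and `y` apart, and then no later level identifies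
    -- them, or all levels agree.
    cₙ-separates : ∀ x y → ∃[ N ] ∀ {k} → N ≤ k → 𝟙^._≈_ k (cₙ k ⟨$⟩ x) (cₙ k ⟨$⟩ y) → x ∼c y
    cₙ-separates x y with em {∃[ N ] ¬ 𝟙^._≈_ N (cₙ N ⟨$⟩ x) (cₙ N ⟨$⟩ y)}
    ... | yes (N , x≉y) = N , λ N≤k e → contradiction (proj-coarser F (cF ⟨$⟩ x) (cF ⟨$⟩ y) N≤k e) x≉y
    ... | no  ¬apart    = 0 , λ _ _ n → decidable-stable em (λ x≉y → ¬apart (n , x≉y))

    -- The finitely many arguments of a and b are separated at one level N, so on
    -- them q factors through c^ N.
    Fq-separated : ∀ {a b : FN.Carrier} → (∀ k → 𝟙^._≈_ (suc k) (F₁ (cₙ k) ⟨$⟩ a) (F₁ (cₙ k) ⟨$⟩ b)) →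
                   Setoid._≈_ (F₀ Q) (F₁ q ⟨$⟩ a) (F₁ q ⟨$⟩ b)
    Fq-separated {a} {b} e = begin
      F₁ q ⟨$⟩ a                              ≈⟨ F₁q≈ a a↪ ⟨
      F₁ f ⟨$⟩ (F₁ (cₙ N) ⟨$⟩ a)              ≈⟨ cong (F₁ f) (e N) ⟩
      F₁ f ⟨$⟩ (F₁ (cₙ N) ⟨$⟩ b)              ≈⟨ F₁q≈ b b↪ ⟩
      F₁ q ⟨$⟩ b                              ∎
      where
      open SetoidReasoning (F₀ Q)

      args : (d : FN.Carrier) → Fin (proj₁ (presented P ν d)) → N.Carrier
      args d = proj₂ (proj₂ (presented P ν d))

      zs : Fin (proj₁ (presented P ν a) + proj₁ (presented P ν b)) → N.Carrier
      zs = args a ++ args b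

      uniform : ∃[ N ] ∀ i {k} → N ≤ k → ∀ j → 𝟙^._≈_ k (cₙ k ⟨$⟩ zs i) (cₙ k ⟨$⟩ zs j) → zs i ∼c zs j
      uniform = ∃-uniform (λ i → let N , sep = ∃-uniform (λ j → cₙ-separates (zs i) (zs j)) in
                                 N , λ N≤k j → sep j N≤k)

      N : ℕ
      N = proj₁ uniform

      extension : Σ[ f ∈ _^_ F (𝟙 ℓ) N ⇒ Q ] ∀ i → (f ⟨$⟩ (cₙ N ⟨$⟩ zs i)) ∼c zs i
      -- The default value is the element of νF given by the base point.
      extension = extendAlong em Q (_^_ F (𝟙 ℓ) N) (mF ⟨$⟩ (ρ 0 ⟨$⟩ _)) zs (λ i → cₙ N ⟨$⟩ zs i)
                    (λ i j → proj₂ uniform i ≤-refl j)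

      f : _^_ F (𝟙 ℓ) N ⇒ Q
      f = proj₁ extension

      a↪ : ∀ i → ∃[ j ] zs j ≡ args a i
      a↪ i = i ↑ˡ _ , lookup-++ˡ (args a) (args b) i

      b↪ : ∀ i → ∃[ j ] zs j ≡ args b i
      b↪ i = _ ↑ʳ i , lookup-++ʳ (args a) (args b) i

      F₁q≈ : ∀ d → (∀ i → ∃[ j ] zs j ≡ args d i) →
             Setoid._≈_ (F₀ Q) (F₁ f ⟨$⟩ (F₁ (cₙ N) ⟨$⟩ d)) (F₁ q ⟨$⟩ d)
      F₁q≈ d d↪ = begin
        F₁ f ⟨$⟩ (F₁ (cₙ N) ⟨$⟩ d)                            ≈⟨ F-∘ f (cₙ N) d ⟨
        F₁ (f ∘ₛ cₙ N) ⟨$⟩ d                                  ≈⟨ cong (F₁ (f ∘ₛ cₙ N)) (ε-presented P ν d) ⟨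
        F₁ (f ∘ₛ cₙ N) ⟨$⟩ (ε ν ⟨$⟩ presented P ν d)          ≈⟨ natural (f ∘ₛ cₙ N) _ ⟩
        ε Q ⟨$⟩ (F₁ᴴ (f ∘ₛ cₙ N) ⟨$⟩ presented P ν d)
          ≈⟨ cong (ε Q) (flat≈ (Setoid.refl (Sg _)) fixes) ⟩
        ε Q ⟨$⟩ (F₁ᴴ q ⟨$⟩ presented P ν d)                   ≈⟨ natural q _ ⟨
        F₁ q ⟨$⟩ (ε ν ⟨$⟩ presented P ν d)                    ≈⟨ cong (F₁ q) (ε-presented P ν d) ⟩
        F₁ q ⟨$⟩ d                                            ∎
        where
        open SetFunctor (H Sg) using () renaming (F₁ to F₁ᴴ)

        fixes : ∀ i → (f ⟨$⟩ (cₙ N ⟨$⟩ args d i)) ∼c args d i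
        fixes i with d↪ i
        ... | j , eq = ≡.subst (λ z → (f ⟨$⟩ (cₙ N ⟨$⟩ z)) ∼c z) eq (proj₂ extension j)

    -- The quotient of ν by the kernel of c is again a coalgebra, and unfolding it
    -- inverts the quotient map.
    c-injective : Injective N._≈_ L._≈_ (to cF)
    c-injective {x} {y} e = N.trans (N.sym (unfold∘q x)) (N.trans (cong (unfold τQ) e) (unfold∘q y))
      where
      τQ : Q ⇒ F₀ Q
      τQ = record
        { to   = λ x → F₁ q ⟨$⟩ (τ ⟨$⟩ x)
        ; cong = λ x∼y → Fq-separated (λ k → x∼y (suc k))
        }

      unfold∘q : unfold τQ ∘ₛ q ≋ idₛ ν
      unfold∘q z = N.trans
        (unfold-unique τ (unfold τQ ∘ₛ q) (λ y → FN.trans (unfold-hom τQ y) (FN.sym (F-∘ (unfold τQ) q (τ ⟨$⟩ y)))) z)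
        (N.sym (unfold-unique τ (idₛ ν) (λ y → FN.sym (F-id (τ ⟨$⟩ y))) z))

  -- Cuts of trees and cuts in νF

  k̂-⌈⌉ : ∀ t → (k̂ P T ⟨$⟩ ⌈_⌉ Sg t) N.≈ (mF ⟨$⟩ h P p′ I t)
  -- The two sides are compared after applying the injective `τ`.
  k̂-⌈⌉ (node {n} σ ts) = N.trans (N.sym (τ⁻¹τ _)) (N.trans (cong τ⁻¹ τ-eq) (τ⁻¹τ _))
    where
    open SetoidReasoning (F₀ ν)
    subtrees : Flat Sg (Tree Sg)
    subtrees = n , σ , λ i → ⌈_⌉ Sg (ts i)

    τ-eq : (τ ⟨$⟩ (k̂ P T ⟨$⟩ ⌈_⌉ Sg (node σ ts))) FN.≈ (τ ⟨$⟩ (mF ⟨$⟩ h P p′ I (node σ ts)))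
    τ-eq = begin
      τ ⟨$⟩ (k̂ P T ⟨$⟩ tuple Sg subtrees)                                ≈⟨ unfold-hom _ (tuple Sg subtrees) ⟩
      F₁ (k̂ P T) ⟨$⟩ (ε (νH Sg) ⟨$⟩ untuple Sg (tuple Sg subtrees))      ≈⟨ cong (F₁ (k̂ P T)) (cong (ε (νH Sg)) (τ′-tuple Sg subtrees)) ⟩
      F₁ (k̂ P T) ⟨$⟩ (ε (νH Sg) ⟨$⟩ subtrees)                            ≈⟨ natural (k̂ P T) subtrees ⟩
      ε ν ⟨$⟩ (n , σ , λ i → k̂ P T ⟨$⟩ ⌈_⌉ Sg (ts i))                    ≈⟨ cong (ε ν) (flat≈ (Setoid.refl (Sg n)) (λ i → k̂-⌈⌉ (ts i))) ⟩
      ε ν ⟨$⟩ (n , σ , λ i → mF ⟨$⟩ h P p′ I (ts i))                     ≈⟨ natural mF (n , σ , λ i → h P p′ I (ts i)) ⟨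
      F₁ mF ⟨$⟩ (ε μ ⟨$⟩ (n , σ , λ i → h P p′ I (ts i)))                ≈⟨ τ-m-φ _ ⟨
      τ ⟨$⟩ (mF ⟨$⟩ h P p′ I (node σ ts))                                ∎

  -- Naturality of `ε` moves the cut into the subtrees; at level 0 both sides are the element named
  -- by `p′`. Thus the class of a cut tree depends only on `k̂ s`.
  h-∂′ : ∀ n s → h P p′ I (∂′ Sg p′ n s) M.≈ (∂ n ⟨$⟩ (k̂ P T ⟨$⟩ s))
  h-∂′ zero s = cong φ (FM.trans (cong (ε μ) (flat≈ (Setoid.refl (Sg 0)) (λ ())))
                                 (FM.sym (natural (fromEmpty μ) (0 , p′ , λ ()))))
  h-∂′ (suc n) s = begin
    φ ⟨$⟩ (ε μ ⟨$⟩ (a , σ , λ i → h P p′ I (∂′ Sg p′ n (subtree Sg s i))))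
      ≈⟨ cong φ (cong (ε μ) (flat≈ (Setoid.refl (Sg a)) (λ i → h-∂′ n (subtree Sg s i)))) ⟩
    φ ⟨$⟩ (ε μ ⟨$⟩ (a , σ , λ i → ∂ n ⟨$⟩ (k̂ P T ⟨$⟩ subtree Sg s i)))
      ≈⟨ cong φ (natural (∂ n ∘ₛ k̂ P T) (untuple Sg s)) ⟨
    φ ⟨$⟩ (F₁ (∂ n ∘ₛ k̂ P T) ⟨$⟩ (ε (νH Sg) ⟨$⟩ untuple Sg s))
      ≈⟨ cong φ (F-∘ (∂ n) (k̂ P T) _) ⟩
    φ ⟨$⟩ (F₁ (∂ n) ⟨$⟩ (F₁ (k̂ P T) ⟨$⟩ (ε (νH Sg) ⟨$⟩ untuple Sg s)))
      ≈⟨ cong φ (cong (F₁ (∂ n)) (unfold-hom _ s)) ⟨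
    φ ⟨$⟩ (F₁ (∂ n) ⟨$⟩ (τ ⟨$⟩ (k̂ P T ⟨$⟩ s)))
      ≈⟨ ∂-suc n _ ⟨
    ∂ (suc n) ⟨$⟩ (k̂ P T ⟨$⟩ s) ∎
    where
    open SetoidReasoning μ
    a = proj₁ (rootSymbol Sg s)
    σ = proj₂ (rootSymbol Sg s)

  h-∂′-⌈⌉ : ∀ k t → h P p′ I (∂′ Sg p′ k (⌈_⌉ Sg t)) M.≈ (∂ k ⟨$⟩ (mF ⟨$⟩ h P p′ I t))
  h-∂′-⌈⌉ k t = M.trans (h-∂′ k (⌈_⌉ Sg t)) (cong (∂ k) (k̂-⌈⌉ t))

  -- By `c-m-ρ`, `ρ n` is a split monomorphism.
  ∂-reflects-c^ : ∀ n x y → (∂ n ⟨$⟩ x) M.≈ (∂ n ⟨$⟩ y) → 𝟙^._≈_ n (cₙ n ⟨$⟩ x) (cₙ n ⟨$⟩ y)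
  ∂-reflects-c^ n x y e =
    𝟙^.trans n (𝟙^.sym n (c-m-ρ n _)) (𝟙^.trans n (cong (cₙ n ∘ₛ mF) e) (c-m-ρ n _))

  -- At each level `k` the same two elements of νF are compared, on one side by `∂ k`, on the other
  -- by `cₙ k`; these have the same kernel.
  ∼*-⌈∂′⌉⇔ : ∀ s s′ n → _∼*_ P p′ I s (⌈_⌉ Sg (∂′ Sg p′ n s′)) ⇔
             ((cF ⟨$⟩ (k̂ P T ⟨$⟩ s)) L.≈ (cF ⟨$⟩ (mF ⟨$⟩ (∂ n ⟨$⟩ (k̂ P T ⟨$⟩ s′)))))
  ∼*-⌈∂′⌉⇔ s s′ n = mk⇔
    (λ e k → ∂-reflects-c^ k _ _ (M.trans (M.sym (h-∂′ k s)) (M.trans (e k) (h-cut k))))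
    (λ e k → M.trans (h-∂′ k s) (M.trans (cong (ρ k) (e k)) (M.sym (h-cut k))))
    where
    h-cut : ∀ k → h P p′ I (∂′ Sg p′ k (⌈_⌉ Sg (∂′ Sg p′ n s′))) M.≈
                  (∂ k ⟨$⟩ (mF ⟨$⟩ (∂ n ⟨$⟩ (k̂ P T ⟨$⟩ s′))))
    h-cut k = M.trans (h-∂′-⌈⌉ k (∂′ Sg p′ n s′)) (cong (∂ k ∘ₛ mF) (h-∂′ n s′))

  -- The order by cutting and the common completion

  module Completion (em : ExcludedMiddle ℓ) (ū : μ ⇒ F^ω1 F) (is-ū : Is-ū F I ū) where

    ū≈c∘m : ū ≋ cF ∘ₛ mF
    ū≈c∘m = Is-ū-unique ū (cF ∘ₛ mF) is-ū c-m-inj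

    private
      rₙ : ℕ → F^ω1 F ⇒ F^ω1 F
      rₙ = r F I ū (basePoint P p′)

      _≤ν_ : Rel N.Carrier ℓ
      _≤ν_ = CutBelow P p′ I T

    -- So `r n` leaves coordinate `n` unchanged; all laws of the cut system except `cut-fixed` rest
    -- on this.
    proj-ū-ρ : ∀ n v → 𝟙^._≈_ n (proj₁ (ū ⟨$⟩ (ρ n ⟨$⟩ v)) n) v
    proj-ū-ρ n v = 𝟙^.trans n (ū≈c∘m (ρ n ⟨$⟩ v) n) (c-m-ρ n v)

    cutSystem : CutSystem (F^ω1 F)
    cutSystem = record
      { cut       = rₙ
      ; cut-finer = λ {n} {k} n≤k a →
          cong (ū ∘ₛ ρ n) (proj-coarser F (rₙ k ⟨$⟩ a) a n≤k (proj-ū-ρ k (proj₁ a k)))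
      ; cut-fixed = λ {n} {k} n≤k a →
          cong ū (M.trans (cong (ρ k) (ū≈c∘m (ρ n ⟨$⟩ proj₁ a n) k)) (∂-m-ρ n≤k (proj₁ a n)))
      ; separated = λ {a} {b} e n → 𝟙^.trans n (𝟙^.sym n (proj-ū-ρ n (proj₁ a n)))
                                      (𝟙^.trans n (e n n) (proj-ū-ρ n (proj₁ b n)))
      -- `r n` sees only coordinate `n`, so the diagonal is the required point.
      ; complete  = λ x e →
          ((λ n → proj₁ (x n) n) , λ n → 𝟙^.trans n (proj₂ (x (suc n)) n)
            (𝟙^.trans n (𝟙^.sym n (proj-ū-ρ n (proj₁ (x (suc n)) n)))
              (𝟙^.trans n (e n n) (proj-ū-ρ n (proj₁ (x n) n))))) ,
          λ n → L.refl {rₙ n ⟨$⟩ x n}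
      }

    open CutOrder cutSystem

    c-m-∂ : ∀ n y → (cF ⟨$⟩ (mF ⟨$⟩ (∂ n ⟨$⟩ y))) L.≈ (rₙ n ⟨$⟩ (cF ⟨$⟩ y))
    c-m-∂ n y k = 𝟙^.sym k (ū≈c∘m (∂ n ⟨$⟩ y) k)

    ≤ν⇔c⊑c : ∀ x y → (x ≤ν y) ⇔ ((cF ⟨$⟩ x) ⊑ (cF ⟨$⟩ y))
    ≤ν⇔c⊑c x y = mk⇔ forward backward
      where
      open SetoidReasoning (F^ω1 F)

      forward : x ≤ν y → (cF ⟨$⟩ x) ⊑ (cF ⟨$⟩ y)
      forward (inj₁ x≈y) = inj₁ (cong cF x≈y)
      forward (inj₂ (s , s′ , n , x≈ , y≈ , s∼)) = inj₂ (n , (begin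
        cF ⟨$⟩ x                                          ≈⟨ cong cF x≈ ⟩
        cF ⟨$⟩ (k̂ P T ⟨$⟩ s)                              ≈⟨ Equivalence.to (∼*-⌈∂′⌉⇔ s s′ n) s∼ ⟩
        cF ⟨$⟩ (mF ⟨$⟩ (∂ n ⟨$⟩ (k̂ P T ⟨$⟩ s′)))          ≈⟨ cong (cF ∘ₛ mF ∘ₛ ∂ n) y≈ ⟨
        cF ⟨$⟩ (mF ⟨$⟩ (∂ n ⟨$⟩ y))                       ≈⟨ c-m-∂ n y ⟩
        rₙ n ⟨$⟩ (cF ⟨$⟩ y)                               ∎))

      backward : (cF ⟨$⟩ x) ⊑ (cF ⟨$⟩ y) → x ≤ν y
      backward (inj₁ cx≈cy) = inj₁ (c-injective em cx≈cy)
      -- `treeAt` supplies representatives of `x` and `y` under `k̂`.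
      backward (inj₂ (n , cx≈)) = inj₂ (treeAt P T x , treeAt P T y , n ,
        N.sym (k̂-treeAt P T x) , N.sym (k̂-treeAt P T y) , Equivalence.from (∼*-⌈∂′⌉⇔ _ _ n) (begin
          cF ⟨$⟩ (k̂ P T ⟨$⟩ treeAt P T x)                            ≈⟨ cong cF (k̂-treeAt P T x) ⟩
          cF ⟨$⟩ x                                                   ≈⟨ cx≈ ⟩
          rₙ n ⟨$⟩ (cF ⟨$⟩ y)                                        ≈⟨ c-m-∂ n y ⟨
          cF ⟨$⟩ (mF ⟨$⟩ (∂ n ⟨$⟩ y))                                ≈⟨ cong (cF ∘ₛ mF ∘ₛ ∂ n) (k̂-treeAt P T y) ⟨
          cF ⟨$⟩ (mF ⟨$⟩ (∂ n ⟨$⟩ (k̂ P T ⟨$⟩ treeAt P T y)))         ∎))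

    c-orderMonomorphism : IsOrderMonomorphism N._≈_ L._≈_ _≤ν_ _⊑_ (to cF)
    c-orderMonomorphism = record
      { isOrderHomomorphism = record { cong = cong cF ; mono = λ {x} {y} → Equivalence.to (≤ν⇔c⊑c x y) }
      ; injective           = c-injective em
      ; cancel              = λ {x} {y} → Equivalence.from (≤ν⇔c⊑c x y)
      }

    ≤ν-isPartialOrder : IsPartialOrder N._≈_ _≤ν_
    ≤ν-isPartialOrder = OrderMonomorphism.isPartialOrder c-orderMonomorphism ⊑-isPartialOrder

    νP μP FνP FμP : Poset ℓ ℓ ℓ
    νP  = setoidPoset ν _≤ν_ ≤ν-isPartialOrder
    μP  = inducedPoset mF m-injective ≤ν-isPartialOrder
    FνP = inducedPoset τ⁻¹ (τ⁻¹-injective T) ≤ν-isPartialOrder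
    FμP = inducedPoset φ (φ-injective I) (Poset.isPartialOrder μP)

    c-m-orderMonomorphism : IsOrderMonomorphism M._≈_ L._≈_ (Poset._≤_ μP) _⊑_ (to (cF ∘ₛ mF))
    c-m-orderMonomorphism = record
      { isOrderHomomorphism = record { cong = cong (cF ∘ₛ mF) ; mono = mono }
      ; injective           = λ e → m-injective (injective e)
      ; cancel              = cancel
      }
      where open IsOrderMonomorphism c-orderMonomorphism using (mono; injective; cancel)

    -- The point of μF that `c ∘ m` sends to the cut of `a` at level `n`; since all cuts come from
    -- μF, both posets get the same completion.
    cut-μ : ℕ → L.Carrier → M.Carrier
    cut-μ n a = ρ n ⟨$⟩ proj₁ a n

    c-m-cut-μ : ∀ n a → (cF ⟨$⟩ (mF ⟨$⟩ cut-μ n a)) L.≈ (rₙ n ⟨$⟩ a)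
    c-m-cut-μ n a k = 𝟙^.sym k (ū≈c∘m (cut-μ n a) k)

    ν-completion : IsConservativeCompletion νP cutPoset (to cF)
    ν-completion = isConservativeCompletion em νP (to cF) c-orderMonomorphism
                     (λ n a → mF ⟨$⟩ cut-μ n a) c-m-cut-μ

    μ-completion : IsConservativeCompletion μP cutPoset (to (cF ∘ₛ mF))
    μ-completion = isConservativeCompletion em μP (to (cF ∘ₛ mF)) c-m-orderMonomorphism cut-μ c-m-cut-μ

    -- The structure maps as order isomorphisms, and uniqueness of `τ`

    φ-orderIso : OrderIso FμP μP (to φ)
    φ-orderIso = record
      { isOrderMonomorphism = record
        { isOrderHomomorphism = record { cong = cong φ ; mono = λ x≤y → x≤y }
        ; injective           = φ-injective I
        ; cancel              = λ x≤y → x≤y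
        }
      ; surjective = λ x → (φ⁻¹ ⟨$⟩ x) , λ z≈ → M.trans (cong φ z≈) (φφ⁻¹ x)
      }

    τ-orderIso : OrderIso νP FνP (to τ)
    τ-orderIso = record
      { isOrderMonomorphism = record
        { isOrderHomomorphism = record
          { cong = cong τ
          ; mono = λ {x} {y} x≤y →
              V.trans (V.reflexive (τ⁻¹τ x)) (V.trans x≤y (V.reflexive (N.sym (τ⁻¹τ y))))
          }
        ; injective = λ {x} {y} e → N.trans (N.sym (τ⁻¹τ x)) (N.trans (cong τ⁻¹ e) (τ⁻¹τ y))
        ; cancel    = λ {x} {y} τx≤τy →
            V.trans (V.reflexive (N.sym (τ⁻¹τ x))) (V.trans τx≤τy (V.reflexive (τ⁻¹τ y)))
        }
      ; surjective = λ a → (τ⁻¹ ⟨$⟩ a) , λ z≈ → FN.trans (cong τ z≈) (ττ⁻¹ a)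
      }
      where module V = Poset νP

    τ-continuous : IsContinuous νP FνP (to τ)
    τ-continuous = orderIso⇒continuous νP FνP τ-orderIso

    -- Both maps agree on the image of `m`, as `m` is a coalgebra homomorphism, and all cuts lie in
    -- that image.
    τ-unique : ∀ g → IsContinuous νP FνP g →
               (∀ x → g (mF ⟨$⟩ x) FN.≈ (F₁ mF ⟨$⟩ (φ⁻¹ ⟨$⟩ x))) → ∀ y → g y FN.≈ (τ ⟨$⟩ y)
    τ-unique g g-continuous g-extends =
      continuous-ext em νP (to cF) c-orderMonomorphism (λ n a → mF ⟨$⟩ cut-μ n a) c-m-cut-μ FνP
        g-continuous τ-continuous
        (λ n a → FN.trans (g-extends (cut-μ n a)) (FN.sym (unfold-hom φ⁻¹ (cut-μ n a))))

theorem4p15 :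
  -- Excluded middle: the mathematics takes place in classical set theory.
  {ℓ : Level} → ExcludedMiddle ℓ →
  (F : SetFunctor ℓ) → Finitary F → Setoid.Carrier (SetFunctor.F₀ F (𝟘 ℓ)) →
  (Sg : Signature ℓ) (P : Presentation F Sg) (p′ : Setoid.Carrier (Sg 0))
  (I : InitialAlgebra F) (T : TerminalCoalgebra F) →
  let open SetFunctor F
      open InitialAlgebra I
      open TerminalCoalgebra T
  in
  (ū : μ ⇒ F^ω1 F) → Is-ū F I ū →
  let cF  = c F T
      mF  = m F T I
      _≤_ = CutBelow P p′ I T
      _⊑_ = Below F I ū (basePoint P p′)
  in
  -- (1)
  (∀ x y → (x ≤ y) ⇔ ((cF ⟨$⟩ x) ⊑ (cF ⟨$⟩ y))) ×
  (Σ[ ≤-po ∈ IsPartialOrder (Setoid._≈_ ν) _≤_ ]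
   Σ[ ⊑-po ∈ IsPartialOrder (Setoid._≈_ (F^ω1 F)) _⊑_ ]
   Σ[ m-injective ∈ Injective (Setoid._≈_ μ) (Setoid._≈_ ν) (Func.to mF) ]
   let νP   = setoidPoset ν _≤_ ≤-po
       ωP   = setoidPoset (F^ω1 F) _⊑_ ⊑-po
       μP   = inducedPoset mF m-injective ≤-po
       FνP  = inducedPoset τ⁻¹ (τ⁻¹-injective T) ≤-po
       FμP  = inducedPoset φ (φ-injective I) (Poset.isPartialOrder μP)
       _≈F_ = Setoid._≈_ (F₀ ν)
   in
   -- (2)
   (IsConservativeCompletion νP ωP (Func.to cF) ×
    IsConservativeCompletion μP ωP (Func.to (cF ∘ₛ mF))) ×
   -- (3)
   (OrderIso FμP μP (Func.to φ) ×
    OrderIso νP FνP (Func.to τ) ×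
    IsContinuous νP FνP (Func.to τ) ×
    (∀ x → (τ ⟨$⟩ (mF ⟨$⟩ x)) ≈F (F₁ mF ⟨$⟩ (φ⁻¹ ⟨$⟩ x))) ×
    (∀ g → IsContinuous νP FνP g →
      (∀ x → g (mF ⟨$⟩ x) ≈F (F₁ mF ⟨$⟩ (φ⁻¹ ⟨$⟩ x))) →
      ∀ y → g y ≈F (τ ⟨$⟩ y))))
theorem4p15 em F _ _ Sg P p′ I T ū is-ū =
  ≤ν⇔c⊑c , ≤ν-isPartialOrder , ⊑-isPartialOrder , m-injective ,
  (ν-completion , μ-completion) ,
  φ-orderIso , τ-orderIso , τ-continuous , TerminalCoalgebra.unfold-hom T (InitialAlgebra.φ⁻¹ I) , τ-unique
  where
  open Truncation P p′ I T
  open Completion em ū is-ū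
  open CutOrder cutSystem using (⊑-isPartialOrder)
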